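{- Let $\mathcal I$ be an interpretation of a circuit signature $\Sigma$. Two sequential circuits $f,g\colon m\to n$ are observationally equivalent, $f\sim_{\mathcal I}g$, if and only if $[\![f]\!]^{\mathsf S}_{\mathcal I}=[\![g]\!]^{\mathsf S}_{\mathcal I}$.
   Context: Circuits. A circuit signature $\Sigma$ consists of a finite set $\mathbf V$ of values with a distinguished value $\bullet$, a set $\mathcal P$ of primitive symbols, and functions $\mathrm{dom},\mathrm{cod}\colon\mathcal P\to\mathbb N$. A PROP is a strict symmetric monoidal category with objects $\mathbb N$ and addition as tensor on objects. $\mathbf{CCirc}_\Sigma$ is the PROP freely generated by: $p\colon\mathrm{dom}(p)\to\mathrm{cod}(p)$ for $p\in\mathcal P$, a fork $1\to2$, a join $2\to1$, an introduction $\bullet\colon0\to1$, and an elimination $1\to0$; its morphisms are combinational circuits. $\mathbf{SCirc}_\Sigma$ is the symmetric traced PROP freely generated by these together with a value $v\colon0\to1$ for each $v\in\mathbf V\setminus\{\bullet\}$ and a delay $\delta\colon1\to1$ (the "value" $\bullet$ means the introduction generator); its morphisms are sequential circuits, taken modulo the axioms of symmetric traced monoidal categories. Composition $f;g$ is in diagrammatic order; $\mathrm{Tr}^x$ sends $x+m\to x+n$ to $m\to n$. $\mathrm{fork}_n,\mathrm{join}_n,\mathrm{elim}_n,\bullet_n,\delta_n$ and $\overline v\colon0\to n$ ($\overline v\in\mathbf V^n$) are the wirewise versions on $n$ wires; $\mathrm{reg}(\overline v)\coloneqq(\overline v\otimes\delta_n);\mathrm{join}_n\colon n\to n$. An interpretation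 $\mathcal I$ is a lattice order on $\mathbf V$ with $\bullet$ least (also written $\bot$) and join $\sqcup$, and for each $p\in\mathcal P$ a $\bot$-preserving monotone function $[\![p]\!]\colon\mathbf V^{\mathrm{dom}(p)}\to\mathbf V^{\mathrm{cod}(p)}$. Denotation. $[\![-]\!]^{\mathsf S}_{\mathcal I}$ is the traced PROP morphism sending circuits $m\to n$ to causal, monotone, finitely specified stream functions $(\mathbf V^m)^\omega\to(\mathbf V^n)^\omega$ determined by: primitives act elementwise by $[\![p]\!]$; fork copies; join is the elementwise $\sqcup$; introduction is the constant stream $\bot$; elimination discards; $v\mapsto v::\bot::\bot::\cdots$; $\delta\mapsto(\sigma\mapsto\bot::\sigma)$; the trace of $f\colon(\mathbf V^{x+m})^\omega\to(\mathbf V^{x+n})^\omega$ is $\sigma\mapsto\pi_1(f(\mu_f(\sigma),\sigma))$, with $\mu_f(\sigma)$ the least fixed point of $\tau\mapsto\pi_0(f(\tau,\sigma))$. Reduction rules (applied to subcircuits, modulo axioms of symmetric traced monoidal categories). (Mealy): for combinational $\hat f\colon x+y+z+m\to x+y+n$ and $\overline v\in\mathbf V^z$, a circuit in global trace-delay form $\mathrm{Tr}^{x+y}\big((\mathrm{id}_x\otimes\delta_y\otimes\overline v\otimes\mathrm{id}_m);\hat f\big)$ rewrites to $\mathrm{Tr}^{x+y+z}\big((\mathrm{id}_x\otimes\mathrm{reg}(\bot^y\overline v)\otimes\mathrm{id}_m);\hat f;(\mathrm{id}_{x+y}\otimes\bullet_z\otimes\mathrm{id}_n)\big)$. Every sequential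 circuit is equal to one in global trace-delay form. (IF): for combinational $h\colon x+a\to x+b$, $\mathrm{Tr}^x(h)\rightsquigarrow h^\dagger;(\mathrm{elim}_x\otimes\mathrm{id}_b)$, where $h^0\coloneqq(\bullet_x\otimes\mathrm{id}_a);h$, $h^{k+1}\coloneqq\mathrm{fork}_a;\big((h^k;(\mathrm{id}_x\otimes\mathrm{elim}_b))\otimes\mathrm{id}_a\big);h$, and $h^\dagger\coloneqq h^{d+1}$ with $d$ the length of the longest chain in $\mathbf V^x$. (Str): for combinational $h\colon a\to b$ and $\overline v\in\mathbf V^a$, $\mathrm{reg}(\overline v);h\rightsquigarrow\big((\overline v;h)\otimes(h;\delta_b)\big);\mathrm{join}_b$. Value rules: $v;\mathrm{fork}\rightsquigarrow v\otimes v$; $(v\otimes w);\mathrm{join}\rightsquigarrow v\sqcup w$; $v;\mathrm{elim}\rightsquigarrow\mathrm{id}_0$; $\overline v;p\rightsquigarrow[\![p]\!](\overline v)$. Productivity: for every sequential $f\colon m\to n$ and $\overline v\in\mathbf V^m$, applying (Mealy), (IF), (Str) once successively and then the value rules exhaustively gives $\mathrm{reg}(\overline v);f\rightsquigarrow^*f';\mathrm{reg}(\overline w)$ for some $\overline w\in\mathbf V^n$ and circuit $f'$. Applied successively to an input waveform $\overline v_0,\dots,\overline v_{k-1}\in\mathbf V^m$ (i.e. to $\mathrm{reg}(\overline v_{k-1});\cdots;\mathrm{reg}(\overline v_0);f$, so $f_0=f$ and $\mathrm{reg}(\overline v_i);f_i\rightsquigarrow^*f_{i+1};\mathrm{reg}(\overline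 w_i)$), it produces an output waveform $\overline w_0,\dots,\overline w_{k-1}\in\mathbf V^n$. Observational equivalence. Two sequential circuits $f,g\colon m\to n$ with no more than $c$ delay generators are observationally equivalent under $\mathcal I$, written $f\sim_{\mathcal I}g$, if applying productivity produces the same output waveforms for all input waveforms in $(\mathbf V^m)^\star$ of length $|\mathbf V|^c+1$.
   Formalization: "No more than c delay generators" is taken to bound the delays of f and g together: if c only bounds each circuit separately, waveforms of length |V|^c+1 need not suffice (there are one-delay circuits over an 8-element lattice that first differ at the 10th output). -}

module Defs where

open import Data.Fin using (Fin; toℕ; fromℕ<; inject₁; funToFin; finToFun)
  renaming (suc to fsuc)
import Data.Fin.Properties as Fin
open import Data.Nat using (ℕ; zero; suc; _+_; _*_; _∸_; _^_; _≤_; _<_; z≤n; s≤s)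
open import Data.Nat.Properties as ℕ using (+-assoc; +-identityʳ)
open import Data.Product using (Σ-syntax; ∃-syntax; _×_; _,_; proj₁; proj₂)
open import Data.Sum using (inj₁; inj₂)
open import Data.Vec using (Vec; []; _∷_; _++_; replicate; take; drop; lookup; tabulate)
open import Data.Vec.Properties using (tabulate∘lookup; tabulate-cong)
open import Data.Vec.Relation.Binary.Pointwise.Inductive as Pointwise
  using (Pointwise; []; _∷_)
open import Function using (_↔_; Inverse; _∘_)
open import Function.Properties.Inverse using (Inverse⇒Injection)
open import Relation.Binary.Construct.Closure.ReflexiveTransitive using (Star)
open import Relation.Binary.Definitions using (DecidableEquality; Minimum)
open import Relation.Binary.Lattice.Structures using (IsLattice)
open import Relation.Binary.PropositionalEquality
open import Relation.Nullary using (yes; no)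

record Signature : Set₁ where
  field
    Value  : Set
    ∣V∣    : ℕ
    finite : Value ↔ Fin ∣V∣
    •      : Value
    Prim   : Set
    dom    : Prim → ℕ
    cod    : Prim → ℕ

  infix 4 _≟_
  _≟_ : DecidableEquality Value
  _≟_ = Fin.inj⇒≟ (Inverse⇒Injection finite)

record Interpretation (S : Signature) : Set₁ where
  open Signature S
  infix 4 _⊑_ _⊑ᵛ_
  field
    _⊑_       : Value → Value → Set
    _⊔_ _⊓_   : Value → Value → Value
    isLattice : IsLattice _≡_ _⊑_ _⊔_ _⊓_
    •-minimum : Minimum _⊑_ •

  _⊑ᵛ_ : ∀ {n} → Vec Value n → Vec Value n → Set
  _⊑ᵛ_ = Pointwise _⊑_

  field
    ⟦_⟧ᵖ       : (p : Prim) → Vec Value (dom p) → Vec Value (cod p)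
    ⟦⟧ᵖ-mono   : ∀ p {u v} → u ⊑ᵛ v → ⟦ p ⟧ᵖ u ⊑ᵛ ⟦ p ⟧ᵖ v
    ⟦⟧ᵖ-strict : ∀ p → ⟦ p ⟧ᵖ (replicate (dom p) •) ≡ replicate (cod p) •

data Kind : Set where
  comb sequ : Kind

module Circuits (S : Signature) where
  open Signature S

  infixr 5 _⨾_
  infixr 6 _⊗_
  infix  4 _≈_

  -- Raw terms: `Circuit comb` over the generators of combinational circuits,
  -- `Circuit sequ` with values, delays and traces added.  The morphisms of the
  -- free (traced) PROP are these terms taken up to _≈_ below.
  data Circuit : Kind → ℕ → ℕ → Set where
    prim  : ∀ {κ} (p : Prim) → Circuit κ (dom p) (cod p)
    fork  : ∀ {κ} → Circuit κ 1 2
    join  : ∀ {κ} → Circuit κ 2 1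
    intro : ∀ {κ} → Circuit κ 0 1
    elim  : ∀ {κ} → Circuit κ 1 0
    id    : ∀ {κ} n → Circuit κ n n
    swap  : ∀ {κ} m n → Circuit κ (m + n) (n + m)
    _⨾_   : ∀ {κ l m n} → Circuit κ l m → Circuit κ m n → Circuit κ l n
    _⊗_   : ∀ {κ m n m′ n′} → Circuit κ m n → Circuit κ m′ n′ →
            Circuit κ (m + m′) (n + n′)
    -- Irrelevance of the second argument gives exactly one generator per value.
    val   : (v : Value) → .(v ≢ •) → Circuit sequ 0 1
    delay : Circuit sequ 1 1
    Tr    : ∀ x {m n} → Circuit sequ (x + m) (x + n) → Circuit sequ m n

  CCirc SCirc : ℕ → ℕ → Set
  CCirc = Circuit comb
  SCirc = Circuit sequ

  cast : ∀ {κ m m′ n n′} → m ≡ m′ → n ≡ n′ → Circuit κ m n → Circuit κ m′ n′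
  cast refl refl f = f

  -- The axioms of strict symmetric (traced) monoidal categories.  The relation
  -- is heterogeneous in the arities, so that strictness needs no transport; f ≈ g
  -- only ever relates circuits with propositionally equal arities, and
  -- cast p q f ≈ f holds.
  data _≈_ : ∀ {κ m n m′ n′} → Circuit κ m n → Circuit κ m′ n′ → Set where
    ≈-refl  : ∀ {κ m n} {f : Circuit κ m n} → f ≈ f
    ≈-sym   : ∀ {κ m n m′ n′} {f : Circuit κ m n} {g : Circuit κ m′ n′} →
              f ≈ g → g ≈ f
    ≈-trans : ∀ {κ m n m′ n′ m″ n″} {f : Circuit κ m n} {g : Circuit κ m′ n′}
              {h : Circuit κ m″ n″} → f ≈ g → g ≈ h → f ≈ h
    ⨾-cong  : ∀ {κ l m n l′ m′ n′}
              {f : Circuit κ l m} {f′ : Circuit κ l′ m′}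
              {g : Circuit κ m n} {g′ : Circuit κ m′ n′} →
              f ≈ f′ → g ≈ g′ → f ⨾ g ≈ f′ ⨾ g′
    ⊗-cong  : ∀ {κ m n m′ n′ p q p′ q′}
              {f : Circuit κ m n} {f′ : Circuit κ m′ n′}
              {g : Circuit κ p q} {g′ : Circuit κ p′ q′} →
              f ≈ f′ → g ≈ g′ → f ⊗ g ≈ f′ ⊗ g′
    Tr-cong : ∀ {x m n m′ n′}
              {f : SCirc (x + m) (x + n)} {f′ : SCirc (x + m′) (x + n′)} →
              f ≈ f′ → Tr x {m} {n} f ≈ Tr x {m′} {n′} f′

    ⨾-idˡ   : ∀ {κ m n} {f : Circuit κ m n} → id m ⨾ f ≈ f
    ⨾-idʳ   : ∀ {κ m n} {f : Circuit κ m n} → f ⨾ id n ≈ f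
    ⨾-assoc : ∀ {κ k l m n} {f : Circuit κ k l} {g : Circuit κ l m}
              {h : Circuit κ m n} → (f ⨾ g) ⨾ h ≈ f ⨾ (g ⨾ h)

    ⊗-id        : ∀ {κ} m n → id {κ} m ⊗ id n ≈ id {κ} (m + n)
    interchange : ∀ {κ l m n l′ m′ n′}
                  {f : Circuit κ l m} {g : Circuit κ m n}
                  {f′ : Circuit κ l′ m′} {g′ : Circuit κ m′ n′} →
                  (f ⨾ g) ⊗ (f′ ⨾ g′) ≈ (f ⊗ f′) ⨾ (g ⊗ g′)
    ⊗-unitˡ     : ∀ {κ m n} {f : Circuit κ m n} → id 0 ⊗ f ≈ f
    ⊗-unitʳ     : ∀ {κ m n} {f : Circuit κ m n} → f ⊗ id 0 ≈ f
    ⊗-assoc     : ∀ {κ m n m′ n′ m″ n″} {f : Circuit κ m n}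
                  {g : Circuit κ m′ n′} {h : Circuit κ m″ n″} →
                  (f ⊗ g) ⊗ h ≈ f ⊗ (g ⊗ h)

    swap-natural    : ∀ {κ m n m′ n′} {f : Circuit κ m n} {g : Circuit κ m′ n′} →
                      (f ⊗ g) ⨾ swap n n′ ≈ swap m m′ ⨾ (g ⊗ f)
    swap-involutive : ∀ {κ} m n → swap {κ} m n ⨾ swap n m ≈ id {κ} (m + n)
    swap-unit       : ∀ {κ} m → swap {κ} m 0 ≈ id {κ} m
    swap-hexagon    : ∀ {κ} l m n → swap {κ} l (m + n) ≈
                      (swap l m ⊗ id n) ⨾
                      cast {κ} (sym (+-assoc m l n)) refl (id m ⊗ swap l n)

    tightening   : ∀ {x l m n k} {g : SCirc l m} {f : SCirc (x + m) (x + n)}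
                   {h : SCirc n k} →
                   Tr x ((id x ⊗ g) ⨾ f ⨾ (id x ⊗ h)) ≈ g ⨾ Tr x f ⨾ h
    sliding      : ∀ {x y m n} {f : SCirc (x + m) (y + n)} {g : SCirc y x} →
                   Tr x {m} {n} (f ⨾ (g ⊗ id n)) ≈ Tr y {m} {n} ((g ⊗ id m) ⨾ f)
    vanishing₀   : ∀ {m n} {f : SCirc m n} → Tr 0 f ≈ f
    vanishing₊   : ∀ x y {m n} {f : SCirc (x + (y + m)) (x + (y + n))} →
                   Tr (x + y) {m} {n}
                     (cast (sym (+-assoc x y m)) (sym (+-assoc x y n)) f)
                   ≈ Tr y {m} {n} (Tr x f)
    superposing  : ∀ x {m n p q} {f : SCirc (x + m) (x + n)} {g : SCirc p q} →
                   Tr x {m + p} {n + q}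
                     (cast (+-assoc x m p) (+-assoc x n q) (f ⊗ g))
                   ≈ Tr x {m} {n} f ⊗ g
    yanking      : ∀ x → Tr x {x} {x} (swap x x) ≈ id {sequ} x

  -- The number of delays is invariant under _≈_: the axioms neither create, copy nor
  -- discard generators.
  #delays : ∀ {m n} → SCirc m n → ℕ
  #delays (prim _)  = 0
  #delays fork      = 0
  #delays join      = 0
  #delays intro     = 0
  #delays elim      = 0
  #delays (id _)    = 0
  #delays (swap _ _) = 0
  #delays (f ⨾ g)   = #delays f + #delays g
  #delays (f ⊗ g)   = #delays f + #delays g
  #delays (val _ _) = 0
  #delays delay     = 1
  #delays (Tr _ f)  = #delays f

  ⌈_⌉ : ∀ {m n} → CCirc m n → SCirc m n
  ⌈ prim p ⌉   = prim p
  ⌈ fork ⌉     = fork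
  ⌈ join ⌉     = join
  ⌈ intro ⌉    = intro
  ⌈ elim ⌉     = elim
  ⌈ id n ⌉     = id n
  ⌈ swap m n ⌉ = swap m n
  ⌈ f ⨾ g ⌉    = ⌈ f ⌉ ⨾ ⌈ g ⌉
  ⌈ f ⊗ g ⌉    = ⌈ f ⌉ ⊗ ⌈ g ⌉

  forks : ∀ {κ} n → Circuit κ n (n + n)
  forks zero    = id 0
  forks (suc n) = (fork ⊗ forks n) ⨾
    (id 1 ⊗ cast refl (+-assoc n 1 n) (swap 1 n ⊗ id n))

  joins : ∀ {κ} n → Circuit κ (n + n) n
  joins zero    = id 0
  joins (suc n) =
    (id 1 ⊗ cast (+-assoc n 1 n) refl (swap n 1 ⊗ id n)) ⨾ (join ⊗ joins n)

  intros : ∀ {κ} n → Circuit κ 0 n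
  intros zero    = id 0
  intros (suc n) = intro ⊗ intros n

  elims : ∀ {κ} n → Circuit κ n 0
  elims zero    = id 0
  elims (suc n) = elim ⊗ elims n

  delays : ∀ n → SCirc n n
  delays zero    = id 0
  delays (suc n) = delay ⊗ delays n

  value : Value → SCirc 0 1
  value v with v ≟ •
  ... | yes _  = intro
  ... | no v≢• = val v v≢•

  values : ∀ {n} → Vec Value n → SCirc 0 n
  values []       = id 0
  values (v ∷ vs) = value v ⊗ values vs

  reg : ∀ {n} → Vec Value n → SCirc n n
  reg {n} vs = (values vs ⊗ delays n) ⨾ joins n

  iterate : ∀ {x a b} → CCirc (x + a) (x + b) → ℕ → CCirc a (x + b)
  iterate {x} {a} h zero    = (intros x ⊗ id a) ⨾ h
  iterate {x} {a} {b} h (suc k) =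
    forks a ⨾
    ((iterate {x} {a} {b} h k ⨾ cast refl (+-identityʳ x) (id x ⊗ elims b)) ⊗ id a) ⨾
    h

  CircuitRel : Set₁
  CircuitRel = ∀ {m n} → SCirc m n → SCirc m n → Set

  -- One application of a rule in R to a subcircuit, modulo _≈_.
  data Step (R : CircuitRel) : CircuitRel where
    rule    : ∀ {m n} {f g : SCirc m n} → R f g → Step R f g
    ⨾-left  : ∀ {l m n} {f f′ : SCirc l m} {g : SCirc m n} →
              Step R f f′ → Step R (f ⨾ g) (f′ ⨾ g)
    ⨾-right : ∀ {l m n} {f : SCirc l m} {g g′ : SCirc m n} →
              Step R g g′ → Step R (f ⨾ g) (f ⨾ g′)
    ⊗-left  : ∀ {m n p q} {f f′ : SCirc m n} {g : SCirc p q} →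
              Step R f f′ → Step R (f ⊗ g) (f′ ⊗ g)
    ⊗-right : ∀ {m n p q} {f : SCirc m n} {g g′ : SCirc p q} →
              Step R g g′ → Step R (f ⊗ g) (f ⊗ g′)
    Tr-body : ∀ {x m n} {f f′ : SCirc (x + m) (x + n)} →
              Step R f f′ → Step R (Tr x {m} {n} f) (Tr x f′)
    modulo  : ∀ {m n m′ n′} {f g : SCirc m n} {f′ g′ : SCirc m′ n′} →
              f ≈ f′ → Step R f′ g′ → g′ ≈ g → Step R f g

module Semantics (S : Signature) (I : Interpretation S) where
  open Signature S
  open Interpretation I
  open Circuits S
  open IsLattice isLattice
    using (x≤x∨y; y≤x∨y; ∨-least; antisym)
    renaming (refl to ⊑-refl; trans to ⊑-trans)

  infix 4 _⊏ᵛ_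
  _⊏ᵛ_ : ∀ {n} → Vec Value n → Vec Value n → Set
  u ⊏ᵛ v = u ⊑ᵛ v × u ≢ v

  -- The length of a chain is its number of strict steps.
  Chain : ℕ → ℕ → Set
  Chain x d = Σ[ c ∈ (Fin (suc d) → Vec Value x) ]
                (∀ (i : Fin d) → c (inject₁ i) ⊏ᵛ c (fsuc i))

  LongestChain : ℕ → ℕ → Set
  LongestChain x d = Chain x d × (∀ {d′} → Chain x d′ → d′ ≤ d)

  data Mealy : CircuitRel where
    mealy : ∀ x y z {m n} (f̂ : CCirc (x + (y + (z + m))) (x + (y + n)))
            (v : Vec Value z) →
      Mealy
        (Tr (x + y) {m} {n}
          (cast (sym (+-assoc x y m)) (sym (+-assoc x y n))
            ((id x ⊗ (delays y ⊗ (values v ⊗ id m))) ⨾ ⌈ f̂ ⌉)))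
        (Tr (x + (y + z)) {m} {n}
          (cast (sym (+-assoc x (y + z) m))
                (trans (cong (x +_) (sym (+-assoc y z n)))
                       (sym (+-assoc x (y + z) n)))
            ((id x ⊗ (reg (replicate y • ++ v) ⊗ id m)) ⨾
             cast (cong (x +_) (sym (+-assoc y z m))) refl ⌈ f̂ ⌉ ⨾
             (id x ⊗ (id y ⊗ (intros z ⊗ id n))))))

  data IF : CircuitRel where
    if : ∀ x {a b d} (h : CCirc (x + a) (x + b)) → LongestChain x d →
      IF (Tr x {a} {b} ⌈ h ⌉)
         (⌈ iterate {x} {a} {b} h (suc d) ⌉ ⨾ (elims x ⊗ id b))

  data Str : CircuitRel where
    str : ∀ {a b} (h : CCirc a b) (v : Vec Value a) →
      Str (reg v ⨾ ⌈ h ⌉)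
          (((values v ⨾ ⌈ h ⌉) ⊗ (⌈ h ⌉ ⨾ delays b)) ⨾ joins b)

  data ValueRule : CircuitRel where
    v-fork : ∀ v → ValueRule (value v ⨾ fork) (value v ⊗ value v)
    v-join : ∀ v w → ValueRule ((value v ⊗ value w) ⨾ join) (value (v ⊔ w))
    v-elim : ∀ v → ValueRule (value v ⨾ elim) (id 0)
    v-prim : ∀ p v → ValueRule (values v ⨾ prim p) (values (⟦ p ⟧ᵖ v))

  -- reg(v);f reduces to f′;reg(w) by one use each of (Mealy), (IF) and (Str), in
  -- this order, followed by value rules.  The result is not required to be
  -- irreducible: reg(v);f and f′;reg(w) denote the same stream function, so w is
  -- already determined by f and v, however long one goes on applying value rules.
  Productive : ∀ {m n} → SCirc m n → Vec Value m → SCirc m n → Vec Value n → Set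
  Productive {m} {n} f v f′ w =
    ∃[ c₁ ] ∃[ c₂ ] ∃[ c₃ ]
      Step Mealy (reg v ⨾ f) c₁ ×
      Step IF c₁ c₂ ×
      Step Str c₂ c₃ ×
      Star (Step ValueRule {m} {n}) c₃ (f′ ⨾ reg w)

  data Produces {m n} (f : SCirc m n) :
       ∀ {k} → Vec (Vec Value m) k → Vec (Vec Value n) k → Set where
    []  : Produces f [] []
    _∷_ : ∀ {k v w f′} {vs : Vec (Vec Value m) k} {ws} →
          Productive f v f′ w → Produces f′ vs ws → Produces f (v ∷ vs) (w ∷ ws)

  -- Observational equivalence of circuits that have no more than c delays in
  -- total.  After one tick the states of f and g form a pair in V^c, so ∣V∣^c + 1
  -- inputs suffice to tell them apart.  Bounding f and g separately by c would
  -- not do: take V = {⊥, a₀, …, a₅, ⊤}, with the aᵢ pairwise incomparable, and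
  -- one-delay circuits 0 → 1 that emit a₀a₀a₀a₀a₁ repeated and
  -- a₀a₀a₀a₀a₁a₀ repeated; they first differ at the 10th output, and 8¹ + 1 = 9.
  infix 4 _∼[_]_
  _∼[_]_ : ∀ {m n} → SCirc m n → ℕ → SCirc m n → Set
  _∼[_]_ {m} f c g = (vs : Vec (Vec Value m) (∣V∣ ^ c + 1)) →
    ∃[ ws ] Produces f vs ws × Produces g vs ws

  Stream : ℕ → Set
  Stream n = ℕ → Vec Value n

  infix 4 _⊑ˢ_ _≡⟨≤_⟩_
  _⊑ˢ_ : ∀ {n} → Stream n → Stream n → Set
  σ ⊑ˢ τ = ∀ t → σ t ⊑ᵛ τ t

  _≡⟨≤_⟩_ : ∀ {n} → Stream n → ℕ → Stream n → Set
  σ ≡⟨≤ t ⟩ τ = ∀ {s} → s ≤ t → σ s ≡ τ s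

  -- Finite specification is not imposed: all denotations have it, and it plays
  -- no role in their equality.
  record StreamFun (m n : ℕ) : Set where
    field
      apply  : Stream m → Stream n
      causal : ∀ {σ τ} t → σ ≡⟨≤ t ⟩ τ → apply σ t ≡ apply τ t
      mono   : ∀ {σ τ} → σ ⊑ˢ τ → apply σ ⊑ˢ apply τ

    causal≤ : ∀ {σ τ} t → σ ≡⟨≤ t ⟩ τ → apply σ ≡⟨≤ t ⟩ apply τ
    causal≤ t σ≡τ s≤t = causal _ (λ r≤s → σ≡τ (ℕ.≤-trans r≤s s≤t))

  open StreamFun

  infix 4 _≗ˢ_
  _≗ˢ_ : ∀ {m n} → StreamFun m n → StreamFun m n → Set
  F ≗ˢ G = ∀ σ t → apply F σ t ≡ apply G σ t

  ⊑ᵛ-refl : ∀ {n} {v : Vec Value n} → v ⊑ᵛ v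
  ⊑ᵛ-refl = Pointwise.refl ⊑-refl

  ⊑ᵛ-reflexive : ∀ {n} {u v : Vec Value n} → u ≡ v → u ⊑ᵛ v
  ⊑ᵛ-reflexive refl = ⊑ᵛ-refl

  ⊑ᵛ-trans : ∀ {n} {u v w : Vec Value n} → u ⊑ᵛ v → v ⊑ᵛ w → u ⊑ᵛ w
  ⊑ᵛ-trans = Pointwise.trans ⊑-trans

  ⊑ᵛ-antisym : ∀ {n} {u v : Vec Value n} → u ⊑ᵛ v → v ⊑ᵛ u → u ≡ v
  ⊑ᵛ-antisym []       []       = refl
  ⊑ᵛ-antisym (p ∷ ps) (q ∷ qs) = cong₂ _∷_ (antisym p q) (⊑ᵛ-antisym ps qs)

  ⊥ᵛ-minimum : ∀ {n} (v : Vec Value n) → replicate n • ⊑ᵛ v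
  ⊥ᵛ-minimum []       = []
  ⊥ᵛ-minimum (v ∷ vs) = •-minimum v ∷ ⊥ᵛ-minimum vs

  take-mono : ∀ m {n} {u v : Vec Value (m + n)} → u ⊑ᵛ v → take m u ⊑ᵛ take m v
  take-mono zero    _        = []
  take-mono (suc m) (p ∷ ps) = p ∷ take-mono m ps

  drop-mono : ∀ m {n} {u v : Vec Value (m + n)} → u ⊑ᵛ v → drop m u ⊑ᵛ drop m v
  drop-mono zero    ps       = ps
  drop-mono (suc m) (_ ∷ ps) = drop-mono m ps

  ⊔-mono : ∀ {a b c d} → a ⊑ c → b ⊑ d → a ⊔ b ⊑ c ⊔ d
  ⊔-mono a⊑c b⊑d = ∨-least (⊑-trans a⊑c (x≤x∨y _ _)) (⊑-trans b⊑d (y≤x∨y _ _))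

  ⊥ˢ : ∀ {n} → Stream n
  ⊥ˢ {n} _ = replicate n •

  infixr 5 _∷ˢ_ _++ˢ_
  _∷ˢ_ : ∀ {n} → Vec Value n → Stream n → Stream n
  (v ∷ˢ σ) zero    = v
  (v ∷ˢ σ) (suc t) = σ t

  _++ˢ_ : ∀ {m n} → Stream m → Stream n → Stream (m + n)
  (σ ++ˢ τ) t = σ t ++ τ t

  takeˢ : ∀ m {n} → Stream (m + n) → Stream m
  takeˢ m σ t = take m (σ t)

  dropˢ : ∀ m {n} → Stream (m + n) → Stream n
  dropˢ m σ t = drop m (σ t)

  IsLeastFixedPoint : ∀ {x} → StreamFun x x → Stream x → Set
  IsLeastFixedPoint F μ =
    (∀ t → apply F μ t ≡ μ t) × (∀ τ → (∀ t → apply F τ t ≡ τ t) → μ ⊑ˢ τ)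

  encode : ∀ {x} → Vec Value x → Fin (∣V∣ ^ x)
  encode v = funToFin (Inverse.to finite ∘ lookup v)

  encode-injective : ∀ {x} {u v : Vec Value x} → encode u ≡ encode v → u ≡ v
  encode-injective {x} {u} {v} eq = begin
    u                              ≡⟨ tabulate∘lookup u ⟨
    tabulate (lookup u)   ≡⟨ tabulate-cong (λ i → to-injective (eqᵢ i)) ⟩
    tabulate (lookup v)   ≡⟨ tabulate∘lookup v ⟩
    v                              ∎
    where
    open ≡-Reasoning
    to = Inverse.to finite
    to-injective : ∀ {a b} → to a ≡ to b → a ≡ b
    to-injective {a} {b} e = trans (sym (Inverse.strictlyInverseʳ finite a))
      (trans (cong (Inverse.from finite) e) (Inverse.strictlyInverseʳ finite b))
    eqᵢ : ∀ i → to (lookup u i) ≡ to (lookup v i)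
    eqᵢ i = trans (sym (Fin.finToFun-funToFin (to ∘ lookup u) i))
      (trans (cong (λ k → finToFun k i) eq)
             (Fin.finToFun-funToFin (to ∘ lookup v) i))

  module LeastFixedPoint {x} (F : StreamFun x x) where
    iter : ℕ → Stream x
    iter zero    = ⊥ˢ
    iter (suc k) = apply F (iter k)

    -- By causality and finiteness of Value, the first t + 1 entries of the
    -- iterates are stationary from this index on.
    bound : ℕ → ℕ
    bound t = suc t * ∣V∣ ^ x

    lfp : Stream x
    lfp t = iter (bound t) t

    iter-step : ∀ k → iter k ⊑ˢ iter (suc k)
    iter-step zero    t = ⊥ᵛ-minimum _
    iter-step (suc k)   = mono F (iter-step k)

    iter-mono : ∀ {k} j → iter k ⊑ˢ iter (j + k)
    iter-mono zero    t = ⊑ᵛ-refl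
    iter-mono {k} (suc j) t = ⊑ᵛ-trans (iter-mono j t) (iter-step (j + k) t)

    iter-mono-≤ : ∀ {j k} → j ≤ k → iter j ⊑ˢ iter k
    iter-mono-≤ {j} {k} j≤k t =
      subst (λ i → iter j t ⊑ᵛ iter i t) (ℕ.m∸n+n≡m j≤k) (iter-mono (k ∸ j) t)

    Stable : ℕ → ℕ → Set
    Stable t k = ∀ {s} → s ≤ t → iter (suc k) s ≡ iter k s

    stable-suc : ∀ {t k} → Stable t k → Stable t (suc k)
    stable-suc {t} st = causal≤ F t st

    stable-+ : ∀ {t k} j → Stable t k → Stable t (j + k)
    stable-+ zero    st = st
    stable-+ {k = k} (suc j) st = stable-suc {k = j + k} (stable-+ {k = k} j st)

    stable-≤ : ∀ {t k k′} → k ≤ k′ → Stable t k → Stable t k′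
    stable-≤ {t} {k} {k′} k≤k′ st {s} =
      subst (λ i → Stable t i) (ℕ.m∸n+n≡m k≤k′) (stable-+ {k = k} (k′ ∸ k) st) {s}

    iter-stable : ∀ {t k} j → Stable t k → iter (j + k) t ≡ iter k t
    iter-stable zero    st = refl
    iter-stable {k = k} (suc j) st =
      trans (stable-+ {k = k} j st ℕ.≤-refl) (iter-stable j st)

    iter-stable-≤ : ∀ {t k k′} → k ≤ k′ → Stable t k → iter k′ t ≡ iter k t
    iter-stable-≤ {t} {k} {k′} k≤k′ st =
      subst (λ i → iter i t ≡ iter k t) (ℕ.m∸n+n≡m k≤k′)
        (iter-stable (k′ ∸ k) st)

    repeats : ∀ t k → Σ[ j ∈ ℕ ] j ≤ ∣V∣ ^ x × iter (suc (j + k)) t ≡ iter (j + k) t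
    repeats t k
      with i , j , i<j , eq ← Fin.pigeonhole ℕ.≤-refl
                                (λ (i : Fin (suc (∣V∣ ^ x))) → encode (iter (toℕ i + k) t))
      = toℕ i
      , ℕ.≤-pred (Fin.toℕ<n i)
      , ⊑ᵛ-antisym
          (⊑ᵛ-trans (iter-mono-≤ (ℕ.+-monoˡ-≤ k i<j) t)
                    (⊑ᵛ-reflexive (sym (encode-injective eq))))
          (iter-step (toℕ i + k) t)

    stable-bound : ∀ t → Stable t (bound t)
    stable-from  : ∀ t k → (∀ {s} → s < t → iter (suc k) s ≡ iter k s) →
                   Stable t (∣V∣ ^ x + k)

    stable-from t k below with j , j≤N , eq ← repeats t k =
      stable-≤ (ℕ.+-monoˡ-≤ k j≤N) stable
      where
      lower : ∀ i {s} → s < t → iter (suc (i + k)) s ≡ iter (i + k) s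
      lower zero    s<t = below s<t
      lower (suc i) s<t =
        causal F _ (λ r≤s → lower i (ℕ.≤-<-trans r≤s s<t))
      stable : Stable t (j + k)
      stable {s} s≤t with ℕ.m≤n⇒m<n∨m≡n s≤t
      ... | inj₁ s<t  = lower j s<t
      ... | inj₂ refl = eq

    stable-bound zero    = stable-from zero 0 (λ ())
    stable-bound (suc t) = stable-from (suc t) (bound t)
      (λ s<1+t → stable-bound t (ℕ.≤-pred s<1+t))

    lfp-iter : ∀ t → lfp ≡⟨≤ t ⟩ iter (bound t)
    lfp-iter t {s} s≤t = sym (iter-stable-≤
      (ℕ.*-monoˡ-≤ (∣V∣ ^ x) (s≤s s≤t)) (stable-bound s))

    lfp-fixed : ∀ t → apply F lfp t ≡ lfp t
    lfp-fixed t = trans (causal F t (lfp-iter t)) (stable-bound t ℕ.≤-refl)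

    lfp-induction : ∀ {τ} → apply F τ ⊑ˢ τ → lfp ⊑ˢ τ
    lfp-induction {τ} Fτ⊑τ t = below (bound t) t
      where
      below : ∀ k → iter k ⊑ˢ τ
      below zero    t = ⊥ᵛ-minimum _
      below (suc k) t = ⊑ᵛ-trans (mono F (below k) t) (Fτ⊑τ t)

    lfp-isLeastFixedPoint : IsLeastFixedPoint F lfp
    lfp-isLeastFixedPoint =
      lfp-fixed , λ τ Fτ≡τ → lfp-induction (λ t → ⊑ᵛ-reflexive (Fτ≡τ t))

  open LeastFixedPoint using (iter; lfp; lfp-fixed; lfp-induction)

  elementwise : ∀ {m n} (φ : Vec Value m → Vec Value n) →
                (∀ {u v} → u ⊑ᵛ v → φ u ⊑ᵛ φ v) → StreamFun m n
  elementwise φ φ-mono = record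
    { apply  = λ σ t → φ (σ t)
    ; causal = λ t σ≡τ → cong φ (σ≡τ ℕ.≤-refl)
    ; mono   = λ σ⊑τ t → φ-mono (σ⊑τ t)
    }

  constant : ∀ {n} → Stream n → StreamFun 0 n
  constant ρ = record
    { apply  = λ _ → ρ
    ; causal = λ _ _ → refl
    ; mono   = λ _ _ → ⊑ᵛ-refl
    }

  delayˢ : StreamFun 1 1
  delayˢ = record
    { apply  = λ σ → replicate 1 • ∷ˢ σ
    ; causal = λ { zero _ → refl ; (suc t) σ≡τ → σ≡τ (ℕ.n≤1+n t) }
    ; mono   = λ { _ zero → ⊑ᵛ-refl ; σ⊑τ (suc t) → σ⊑τ t }
    }

  composeˢ : ∀ {l m n} → StreamFun l m → StreamFun m n → StreamFun l n
  composeˢ F G = record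
    { apply  = λ σ → apply G (apply F σ)
    ; causal = λ t σ≡τ → causal G t (causal≤ F t σ≡τ)
    ; mono   = λ σ⊑τ → mono G (mono F σ⊑τ)
    }

  tensorˢ : ∀ {m n m′ n′} → StreamFun m n → StreamFun m′ n′ →
            StreamFun (m + m′) (n + n′)
  tensorˢ {m} F G = record
    { apply  = λ σ → apply F (takeˢ m σ) ++ˢ apply G (dropˢ m σ)
    ; causal = λ t σ≡τ → cong₂ _++_
        (causal F t (λ s≤t → cong (take m) (σ≡τ s≤t)))
        (causal G t (λ s≤t → cong (drop m) (σ≡τ s≤t)))
    ; mono   = λ σ⊑τ t → Pointwise.++⁺
        (mono F (λ s → take-mono m (σ⊑τ s)) t)
        (mono G (λ s → drop-mono m (σ⊑τ s)) t)
    }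

  feedback : ∀ x {m n} → StreamFun (x + m) (x + n) → Stream m → StreamFun x x
  feedback x F σ = record
    { apply  = λ τ → takeˢ x (apply F (τ ++ˢ σ))
    ; causal = λ t τ≡τ′ → cong (take x)
        (causal F t (λ {s} s≤t → cong (_++ σ s) (τ≡τ′ s≤t)))
    ; mono   = λ τ⊑τ′ t → take-mono x
        (mono F (λ s → Pointwise.++⁺ (τ⊑τ′ s) ⊑ᵛ-refl) t)
    }

  traceˢ : ∀ x {m n} → StreamFun (x + m) (x + n) → StreamFun m n
  traceˢ x {m} F = record
    { apply  = λ σ → dropˢ x (apply F (μ σ ++ˢ σ))
    ; causal = λ t σ≡τ → cong (drop x)
        (causal F t (λ s≤t → cong₂ _++_ (μ-causal t σ≡τ s≤t) (σ≡τ s≤t)))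
    ; mono   = λ σ⊑τ t → drop-mono x
        (mono F (λ s → Pointwise.++⁺ (μ-mono σ⊑τ s) (σ⊑τ s)) t)
    }
    where
    μ : Stream m → Stream x
    μ σ = lfp (feedback x F σ)

    iter-causal : ∀ {σ τ} t → σ ≡⟨≤ t ⟩ τ → ∀ k →
                  iter (feedback x F σ) k ≡⟨≤ t ⟩ iter (feedback x F τ) k
    iter-causal t σ≡τ zero    s≤t = refl
    iter-causal t σ≡τ (suc k) s≤t = cong (take x) (causal≤ F t
      (λ r≤t → cong₂ _++_ (iter-causal t σ≡τ k r≤t) (σ≡τ r≤t)) s≤t)

    μ-causal : ∀ {σ τ} t → σ ≡⟨≤ t ⟩ τ → μ σ ≡⟨≤ t ⟩ μ τ
    μ-causal {σ} t σ≡τ {s} s≤t =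
      iter-causal t σ≡τ (LeastFixedPoint.bound (feedback x F σ) s) s≤t

    μ-mono : ∀ {σ τ} → σ ⊑ˢ τ → μ σ ⊑ˢ μ τ
    μ-mono {σ} {τ} σ⊑τ = lfp-induction (feedback x F σ) λ t → ⊑ᵛ-trans
      (take-mono x (mono F (λ s → Pointwise.++⁺ ⊑ᵛ-refl (σ⊑τ s)) t))
      (⊑ᵛ-reflexive (lfp-fixed (feedback x F τ) t))

  ⟦_⟧ˢ : ∀ {m n} → SCirc m n → StreamFun m n
  ⟦ prim p ⟧ˢ   = elementwise ⟦ p ⟧ᵖ (⟦⟧ᵖ-mono p)
  ⟦ fork ⟧ˢ     = elementwise (λ { (a ∷ []) → a ∷ a ∷ [] })
                              (λ { (p ∷ []) → p ∷ p ∷ [] })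
  ⟦ join ⟧ˢ     = elementwise (λ { (a ∷ b ∷ []) → a ⊔ b ∷ [] })
                              (λ { (p ∷ q ∷ []) → ⊔-mono p q ∷ [] })
  ⟦ intro ⟧ˢ    = constant ⊥ˢ
  ⟦ elim ⟧ˢ     = elementwise (λ _ → []) (λ _ → [])
  ⟦ id n ⟧ˢ     = elementwise (λ v → v) (λ p → p)
  ⟦ swap m n ⟧ˢ = elementwise (λ v → drop m v ++ take m v)
                              (λ p → Pointwise.++⁺ (drop-mono m p) (take-mono m p))
  ⟦ f ⨾ g ⟧ˢ    = composeˢ ⟦ f ⟧ˢ ⟦ g ⟧ˢ
  ⟦ f ⊗ g ⟧ˢ    = tensorˢ ⟦ f ⟧ˢ ⟦ g ⟧ˢ
  ⟦ val v _ ⟧ˢ  = constant ((v ∷ []) ∷ˢ ⊥ˢ)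
  ⟦ delay ⟧ˢ    = delayˢ
  ⟦ Tr x f ⟧ˢ   = traceˢ x ⟦ f ⟧ˢ

{-# OPTIONS --safe #-}
-- Denotations are sound for the axioms and the reduction rules, so productivity can
-- only ever output the head of the denoted stream and continue with a circuit that
-- denotes its tail.  It always applies: pulling the delays and values of a circuit
-- out of it one by one, through traces, brings it to global trace-delay form.
-- Hence equal denotations give equal waveforms.  Conversely, the stream emitted
-- after a tick depends only on the contents of the delays and on the inputs still
-- to come.  On an input of more than ∣V∣ ^ c + 1 ticks some pair of states of f and g
-- recurs, and cutting out the inputs between its occurrences leaves the last
-- outputs of f and g unchanged; so a difference shows on a short input already.
module Submission where

open import Defs
open import Data.Empty using (⊥-elim; ⊥-elim-irr)
open import Data.Fin using (Fin; zero; toℕ; inject₁) renaming (suc to fsuc)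
import Data.Fin.Properties as Fin
import Data.List as List
import Data.List.Properties as List
open import Data.Nat using (ℕ; zero; suc; _+_; _^_; _∸_; _≤_; _<_; z≤n; s≤s; >-nonZero)
open import Data.Nat.Induction using (<-rec)
open import Data.Nat.Properties as ℕ using (+-assoc; +-identityʳ; +-cancelˡ-≡)
open import Data.Product using (Σ-syntax; ∃-syntax; _×_; _,_; proj₁; proj₂)
open import Data.Sum using (_⊎_; inj₁; inj₂)
open import Data.Unit using (⊤; tt)
open import Data.Vec using (Vec; []; _∷_; _++_; replicate; splitAt; take; drop; toList)
open import Data.Vec.Properties
  using (toList-injective; take++drop≡id; cast-is-id; ≡-dec; ++-injective)
open import Data.Vec.Relation.Binary.Pointwise.Inductive as Pointwise using (Pointwise)
open import Function using (Inverse; _∘_)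
open import Function.Bundles using (_⇔_; mk⇔)
open import Relation.Binary.Construct.Closure.ReflexiveTransitive using (Star; ε; _◅_)
open import Relation.Binary.Lattice.Structures using (IsLattice)
open import Relation.Binary.PropositionalEquality
open import Relation.Nullary using (Dec; yes; no; contradiction)
open import Relation.Nullary.Decidable using (map′; _×-dec_; ¬?)
open import Relation.Unary using (Decidable)

-- The counting is done on the denotations of `f` and `g`, along their given syntax, and not on the
-- circuits that productivity leaves behind: (Mealy) turns every value into a register, so a reduct
-- may hold more delays than the circuit it came from. Productivity only supplies the outputs.
--
-- Delay contents determine the future only once a tick has passed, because a value emits `v` at
-- tick 0 and ⊥ ever after. This is the origin of the summand 1 in the waveform length: states are
-- compared after ticks among 0 to ∣V∣ ^ c, which are more ticks than there are pairs of states, and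
-- these are exactly the ticks covered by ∣V∣ ^ c + 1 inputs.
--
-- The tensor is strictly associative, while addition of arities is so only propositionally.
-- Circuits are therefore related heterogeneously, and streams of vectors are compared through their
-- lists of entries, which keeps casts out of the fixed-point arguments.

module _ {A : Set} where

  -- Vectors of propositionally equal length

  toList-inj : ∀ {n} {u v : Vec A n} → toList u ≡ toList v → u ≡ v
  toList-inj {u = u} {v} eq = trans (sym (cast-is-id refl u)) (toList-injective refl u v eq)

  []-unique : (u v : Vec A 0) → u ≡ v
  []-unique [] [] = refl

  take-++ : ∀ {m n} (u : Vec A m) (v : Vec A n) → take m (u ++ v) ≡ u
  take-++ []      v = refl
  take-++ (a ∷ u) v = cong (a ∷_) (take-++ u v)

  drop-++ : ∀ {m n} (u : Vec A m) (v : Vec A n) → drop m (u ++ v) ≡ v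
  drop-++ []      v = refl
  drop-++ (a ∷ u) v = drop-++ u v

  -- `v` and `v′` are one vector under two bracketings of its length; equality of lists says so
  -- without a cast. Together with `drop-take` and `drop-+` this reads off the three blocks in
  -- either bracketing.
  take-take : ∀ l m {n} (v : Vec A ((l + m) + n)) (v′ : Vec A (l + (m + n))) →
              toList v ≡ toList v′ → take l (take (l + m) v) ≡ take l v′
  take-take zero    m v v′ eq = refl
  take-take (suc l) m (a ∷ v) (b ∷ v′) eq =
    cong₂ _∷_ (List.∷-injectiveˡ eq) (take-take l m v v′ (List.∷-injectiveʳ eq))

  drop-take : ∀ l m {n} (v : Vec A ((l + m) + n)) (v′ : Vec A (l + (m + n))) →
              toList v ≡ toList v′ → drop l (take (l + m) v) ≡ take m (drop l v′)
  drop-take zero    m v v′ eq = cong (take m) (toList-inj eq)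
  drop-take (suc l) m (a ∷ v) (b ∷ v′) eq = drop-take l m v v′ (List.∷-injectiveʳ eq)

  drop-+ : ∀ l m {n} (v : Vec A ((l + m) + n)) (v′ : Vec A (l + (m + n))) →
           toList v ≡ toList v′ → drop (l + m) v ≡ drop m (drop l v′)
  drop-+ zero    m v v′ eq = cong (drop m) (toList-inj eq)
  drop-+ (suc l) m (a ∷ v) (b ∷ v′) eq = drop-+ l m v v′ (List.∷-injectiveʳ eq)

  toList-++-assoc : ∀ {l m n} (u : Vec A l) (v : Vec A m) (w : Vec A n) →
                    toList ((u ++ v) ++ w) ≡ toList (u ++ (v ++ w))
  toList-++-assoc []      v w = refl
  toList-++-assoc (a ∷ u) v w = cong (a List.∷_) (toList-++-assoc u v w)

  toList-++-[] : ∀ {m} (u : Vec A m) (v : Vec A 0) → toList (u ++ v) ≡ toList u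
  toList-++-[] []      [] = refl
  toList-++-[] (a ∷ u) v  = cong (a List.∷_) (toList-++-[] u v)

  take-+0 : ∀ m (v : Vec A (m + 0)) → toList (take m v) ≡ toList v
  take-+0 m v with splitAt m v
  ... | u , w , refl = sym (toList-++-[] u w)

module NormalForms (S : Signature) where
  open Signature S
  open Circuits S

  -- Equational reasoning with circuits

  infix  1 begin_
  infixr 2 step-≈ step-≈˘
  infix  3 _∎

  begin_ : ∀ {κ m n m′ n′} {f : Circuit κ m n} {g : Circuit κ m′ n′} → f ≈ g → f ≈ g
  begin p = p

  step-≈ : ∀ {κ m n m′ n′ m″ n″} (f : Circuit κ m n) {g : Circuit κ m′ n′} {h : Circuit κ m″ n″} →
           g ≈ h → f ≈ g → f ≈ h
  step-≈ f q p = ≈-trans p q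

  step-≈˘ : ∀ {κ m n m′ n′ m″ n″} (f : Circuit κ m n) {g : Circuit κ m′ n′} {h : Circuit κ m″ n″} →
            g ≈ h → g ≈ f → f ≈ h
  step-≈˘ f q p = ≈-trans (≈-sym p) q

  syntax step-≈ f q p = f ≈⟨ p ⟩ q
  syntax step-≈˘ f q p = f ≈⟨ p ⟨ q

  _∎ : ∀ {κ m n} (f : Circuit κ m n) → f ≈ f
  f ∎ = ≈-refl

  cast-≈ : ∀ {κ m m′ n n′} (p : m ≡ m′) (q : n ≡ n′) (f : Circuit κ m n) → cast p q f ≈ f
  cast-≈ refl refl f = ≈-refl

  ⌈cast⌉ : ∀ {m m′ n n′} (p : m ≡ m′) (q : n ≡ n′) (f : CCirc m n) → ⌈ cast p q f ⌉ ≈ ⌈ f ⌉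
  ⌈cast⌉ refl refl f = ≈-refl

  ≡⇒≈ : ∀ {κ m n} {f g : Circuit κ m n} → f ≡ g → f ≈ g
  ≡⇒≈ refl = ≈-refl

  id-cong : ∀ {κ m n} → m ≡ n → id {κ} m ≈ id {κ} n
  id-cong refl = ≈-refl

  module _ {κ : Kind} where

    ⊗-⨾-⊗ : ∀ {l m n l′ m′ n′} {f : Circuit κ l m} {g : Circuit κ m n}
            {f′ : Circuit κ l′ m′} {g′ : Circuit κ m′ n′} →
            (f ⊗ f′) ⨾ (g ⊗ g′) ≈ (f ⨾ g) ⊗ (f′ ⨾ g′)
    ⊗-⨾-⊗ = ≈-sym interchange

    split₁ : ∀ {m n m′ n′} (f : Circuit κ m n) (g : Circuit κ m′ n′) →
             f ⊗ g ≈ (f ⊗ id m′) ⨾ (id n ⊗ g)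
    split₁ f g = ≈-trans (⊗-cong (≈-sym ⨾-idʳ) (≈-sym ⨾-idˡ)) interchange

    split₂ : ∀ {m n m′ n′} (f : Circuit κ m n) (g : Circuit κ m′ n′) →
             f ⊗ g ≈ (id m ⊗ g) ⨾ (f ⊗ id n′)
    split₂ f g = ≈-trans (⊗-cong (≈-sym ⨾-idˡ) (≈-sym ⨾-idʳ)) interchange

    ⨾-⊗-id : ∀ {l m n} p {f : Circuit κ l m} {g : Circuit κ m n} →
             (f ⨾ g) ⊗ id p ≈ (f ⊗ id p) ⨾ (g ⊗ id p)
    ⨾-⊗-id p = ≈-trans (⊗-cong ≈-refl (≈-sym ⨾-idˡ)) interchange

    id-⊗-⨾ : ∀ {l m n} p {f : Circuit κ l m} {g : Circuit κ m n} →
             id p ⊗ (f ⨾ g) ≈ (id p ⊗ f) ⨾ (id p ⊗ g)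
    id-⊗-⨾ p = ≈-trans (⊗-cong (≈-sym ⨾-idˡ) ≈-refl) interchange

    -- Superposing adds wires only on the right of a trace; conjugation with symmetries transfers
    -- this to wires on the left.
    id-⊗-via-swap : ∀ {m n} p (g : Circuit κ m n) →
                    id p ⊗ g ≈ swap p m ⨾ (g ⊗ id p) ⨾ swap n p
    id-⊗-via-swap {m} {n} p g = begin
      id p ⊗ g                               ≈⟨ ⨾-idʳ ⟨
      (id p ⊗ g) ⨾ id (p + n)                ≈⟨ ⨾-cong ≈-refl (swap-involutive p n) ⟨
      (id p ⊗ g) ⨾ (swap p n ⨾ swap n p)     ≈⟨ ⨾-assoc ⟨
      ((id p ⊗ g) ⨾ swap p n) ⨾ swap n p     ≈⟨ ⨾-cong swap-natural ≈-refl ⟩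
      (swap p m ⨾ (g ⊗ id p)) ⨾ swap n p     ≈⟨ ⨾-assoc ⟩
      swap p m ⨾ (g ⊗ id p) ⨾ swap n p       ∎

    -- `swap-unit` treats a zero on the right; this swap is inverse to that one.
    swap-unitˡ : ∀ m → swap {κ} 0 m ≈ id {κ} m
    swap-unitˡ m = begin
      swap 0 m                                ≈⟨ ⨾-idʳ ⟨
      swap 0 m ⨾ id (m + 0)                   ≈⟨ ⨾-cong ≈-refl (≈-trans (swap-unit m) (id-cong (sym (+-identityʳ m)))) ⟨
      swap 0 m ⨾ swap m 0                     ≈⟨ swap-involutive 0 m ⟩
      id m                                    ∎

  tighten : ∀ {x l m n} {g : SCirc l m} {f : SCirc (x + m) (x + n)} →
            g ⨾ Tr x f ≈ Tr x ((id x ⊗ g) ⨾ f)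
  tighten {x} {g = g} {f} = begin
    g ⨾ Tr x f                             ≈⟨ ⨾-cong ≈-refl ⨾-idʳ ⟨
    g ⨾ Tr x f ⨾ id _                      ≈⟨ tightening ⟨
    Tr x ((id x ⊗ g) ⨾ f ⨾ (id x ⊗ id _))  ≈⟨ Tr-cong (⨾-cong ≈-refl (⨾-cong ≈-refl (⊗-id x _))) ⟩
    Tr x ((id x ⊗ g) ⨾ f ⨾ id _)           ≈⟨ Tr-cong (⨾-cong ≈-refl ⨾-idʳ) ⟩
    Tr x ((id x ⊗ g) ⨾ f)                  ∎

  tightenʳ : ∀ {x m n k} {f : SCirc (x + m) (x + n)} {h : SCirc n k} →
             Tr x f ⨾ h ≈ Tr x (f ⨾ (id x ⊗ h))
  tightenʳ {x} {f = f} {h} = begin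
    Tr x f ⨾ h                             ≈⟨ ⨾-idˡ ⟨
    id _ ⨾ Tr x f ⨾ h                      ≈⟨ tightening ⟨
    Tr x ((id x ⊗ id _) ⨾ f ⨾ (id x ⊗ h))  ≈⟨ Tr-cong (⨾-cong (⊗-id x _) ≈-refl) ⟩
    Tr x (id _ ⨾ f ⨾ (id x ⊗ h))           ≈⟨ Tr-cong ⨾-idˡ ⟩
    Tr x (f ⨾ (id x ⊗ h))                  ∎

  delays-++ : ∀ m n → delays (m + n) ≈ delays m ⊗ delays n
  delays-++ zero    n = ≈-sym ⊗-unitˡ
  delays-++ (suc m) n = ≈-trans (⊗-cong ≈-refl (delays-++ m n)) (≈-sym ⊗-assoc)

  values-++ : ∀ {m n} (u : Vec Value m) (v : Vec Value n) → values (u ++ v) ≈ values u ⊗ values v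
  values-++ []      v = ≈-sym ⊗-unitˡ
  values-++ (a ∷ u) v = ≈-trans (⊗-cong ≈-refl (values-++ u v)) (≈-sym ⊗-assoc)

  -- Global trace-delay form

  infix 4 _≲_
  -- In practice `P` and `Q` are rewirings, built from identities and swaps. They are combinational
  -- so that the core of a normal form can absorb them.
  _≲_ : ∀ {m n m′ n′} → SCirc m n → SCirc m′ n′ → Set
  _≲_ {m} {n} {m′} {n′} f g =
    Σ[ P ∈ CCirc m m′ ] Σ[ Q ∈ CCirc n′ n ] f ≈ ⌈ P ⌉ ⨾ g ⨾ ⌈ Q ⌉

  ≈⇒≲ : ∀ {m n m′ n′} {f : SCirc m n} {g : SCirc m′ n′} → m ≡ m′ → n ≡ n′ → f ≈ g → f ≲ g
  ≈⇒≲ refl refl p = id _ , id _ , ≈-trans p (≈-trans (≈-sym ⨾-idʳ) (≈-sym ⨾-idˡ))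

  ≲-trans : ∀ {m n m′ n′ m″ n″} {f : SCirc m n} {g : SCirc m′ n′} {h : SCirc m″ n″} →
            f ≲ g → g ≲ h → f ≲ h
  ≲-trans {f = f} {g} {h} (P , Q , p) (P′ , Q′ , q) = P ⨾ P′ , Q′ ⨾ Q , (begin
    f                                                   ≈⟨ p ⟩
    ⌈ P ⌉ ⨾ g ⨾ ⌈ Q ⌉                                   ≈⟨ ⨾-cong ≈-refl (⨾-cong q ≈-refl) ⟩
    ⌈ P ⌉ ⨾ (⌈ P′ ⌉ ⨾ h ⨾ ⌈ Q′ ⌉) ⨾ ⌈ Q ⌉               ≈⟨ ⨾-cong ≈-refl ⨾-assoc ⟩
    ⌈ P ⌉ ⨾ ⌈ P′ ⌉ ⨾ (h ⨾ ⌈ Q′ ⌉) ⨾ ⌈ Q ⌉               ≈⟨ ⨾-assoc ⟨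
    (⌈ P ⌉ ⨾ ⌈ P′ ⌉) ⨾ (h ⨾ ⌈ Q′ ⌉) ⨾ ⌈ Q ⌉             ≈⟨ ⨾-cong ≈-refl ⨾-assoc ⟩
    (⌈ P ⌉ ⨾ ⌈ P′ ⌉) ⨾ h ⨾ (⌈ Q′ ⌉ ⨾ ⌈ Q ⌉)             ∎)

  ≲-⊗ : ∀ {m n m′ n′ p q p′ q′} {f : SCirc m n} {f′ : SCirc m′ n′} {g : SCirc p q} {g′ : SCirc p′ q′} →
        f ≲ f′ → g ≲ g′ → f ⊗ g ≲ f′ ⊗ g′
  ≲-⊗ (P , Q , p) (P′ , Q′ , q) = P ⊗ P′ , Q ⊗ Q′ ,
    ≈-trans (⊗-cong p q) (≈-trans interchange (⨾-cong ≈-refl interchange))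

  ≲-refl : ∀ {m n} {f : SCirc m n} → f ≲ f
  ≲-refl = ≈⇒≲ refl refl ≈-refl

  ≲-swap : ∀ {m n p q} (f : SCirc m n) (g : SCirc p q) → f ⊗ g ≲ g ⊗ f
  ≲-swap {m} {n} {p} {q} f g = swap m p , swap q n , (begin
    f ⊗ g                              ≈⟨ ⨾-idʳ ⟨
    (f ⊗ g) ⨾ id (n + q)               ≈⟨ ⨾-cong ≈-refl (swap-involutive n q) ⟨
    (f ⊗ g) ⨾ (swap n q ⨾ swap q n)    ≈⟨ ⨾-assoc ⟨
    ((f ⊗ g) ⨾ swap n q) ⨾ swap q n    ≈⟨ ⨾-cong swap-natural ≈-refl ⟩
    (swap m p ⨾ (g ⊗ f)) ⨾ swap q n    ≈⟨ ⨾-assoc ⟩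
    swap m p ⨾ (g ⊗ f) ⨾ swap q n      ∎)

  ≲-assoc : ∀ {m n m′ n′ m″ n″} (f : SCirc m n) (g : SCirc m′ n′) (h : SCirc m″ n″) →
            (f ⊗ g) ⊗ h ≲ f ⊗ (g ⊗ h)
  ≲-assoc {m} {n} {m′} {n′} f g h = ≈⇒≲ (+-assoc m m′ _) (+-assoc n n′ _) ⊗-assoc

  ≲-assoc˘ : ∀ {m n m′ n′ m″ n″} (f : SCirc m n) (g : SCirc m′ n′) (h : SCirc m″ n″) →
             f ⊗ (g ⊗ h) ≲ (f ⊗ g) ⊗ h
  ≲-assoc˘ {m} {n} {m′} {n′} f g h =
    ≈⇒≲ (sym (+-assoc m m′ _)) (sym (+-assoc n n′ _)) (≈-sym ⊗-assoc)

  ≲-middle : ∀ {m n p q m′ n′ p′ q′} (a : SCirc m n) (b : SCirc p q)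
             (c : SCirc m′ n′) (d : SCirc p′ q′) →
             (a ⊗ b) ⊗ (c ⊗ d) ≲ (a ⊗ c) ⊗ (b ⊗ d)
  ≲-middle a b c d =
    ≲-trans (≲-assoc a b (c ⊗ d))
    (≲-trans (≲-⊗ ≲-refl (≲-trans (≲-assoc˘ b c d)
                         (≲-trans (≲-⊗ (≲-swap b c) ≲-refl) (≲-assoc c b d))))
             (≲-assoc˘ a c (b ⊗ d)))

  -- Tensors of wires, delays and values, in any order.
  Boxes : ∀ {m n} → SCirc m n → Set
  Boxes B = ∃[ x ] ∃[ y ] ∃[ z ] Σ[ v ∈ Vec Value z ] B ≲ id x ⊗ (delays y ⊗ values v)

  -- Two uses of `≲-middle` sort the tensor: the outer one gathers the plain wires, the inner one
  -- separates delays from values.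
  Boxes-⊗ : ∀ {m n p q} {B : SCirc m n} {C : SCirc p q} → Boxes B → Boxes C → Boxes (B ⊗ C)
  Boxes-⊗ {B = B} {C} (x , y , z , v , b) (x′ , y′ , z′ , v′ , c) =
    x + x′ , y + y′ , z + z′ , v ++ v′ ,
    ≲-trans (≲-⊗ b c)
    (≲-trans (≲-middle _ _ _ _)
    (≲-⊗ (≈⇒≲ refl refl (⊗-id x x′))
      (≲-trans (≲-middle _ _ _ _)
        (≲-⊗ (≈⇒≲ refl refl (≈-sym (delays-++ y y′)))
             (≈⇒≲ refl refl (≈-sym (values-++ v v′)))))))

  Boxes-id : ∀ n → Boxes (id n)
  Boxes-id n = n , 0 , 0 , [] , ≈⇒≲ (sym (+-identityʳ n)) (sym (+-identityʳ n))
    (≈-trans (≈-sym ⊗-unitʳ) (⊗-cong ≈-refl (≈-sym ⊗-unitˡ)))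

  Boxes-delay : Boxes delay
  Boxes-delay = 0 , 1 , 0 , [] , ≈⇒≲ refl refl
    (≈-trans (≈-sym ⊗-unitʳ) (≈-trans (≈-sym ⊗-unitʳ) (≈-sym ⊗-unitˡ)))

  Boxes-val : ∀ v .v≢• → Boxes (val v v≢•)
  Boxes-val v v≢• = 0 , 0 , 1 , v ∷ [] , ≈⇒≲ refl refl (begin
    val v _                             ≈⟨ value-val v v≢• ⟩
    value v                             ≈⟨ ⊗-unitʳ ⟨
    value v ⊗ id 0                      ≈⟨ ⊗-unitˡ ⟨
    id 0 ⊗ (value v ⊗ id 0)             ≈⟨ ⊗-unitˡ ⟨
    id 0 ⊗ (id 0 ⊗ (value v ⊗ id 0))    ∎)
    where
    value-val : ∀ v .(v≢• : v ≢ •) → val v v≢• ≈ value v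
    value-val v v≢• with v ≟ •
    ... | yes v≡• = ⊥-elim-irr (v≢• v≡•)
    ... | no _ = ≈-refl

  -- The boxes stay in the order in which they were pulled out; their sorted version is recorded
  -- only up to rewiring. Only the `s` inputs are traced, and `s′` may be larger because values have
  -- no inputs.
  record Form {m n} (f : SCirc m n) : Set where
    constructor form
    field
      {s s′} : ℕ
      boxes  : SCirc s s′
      isBoxes : Boxes boxes
      core   : CCirc (s′ + m) (s + n)
      eq     : f ≈ Tr s {m} {n} ((boxes ⊗ id m) ⨾ ⌈ core ⌉)

  Form-resp-≈ : ∀ {m n} {f g : SCirc m n} → g ≈ f → Form f → Form g
  Form-resp-≈ p (form B b k q) = form B b k (≈-trans p q)

  Form-comb : ∀ {m n} (f : CCirc m n) → Form ⌈ f ⌉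
  Form-comb {m} f = form (id 0) (Boxes-id 0) f (begin
    ⌈ f ⌉                              ≈⟨ vanishing₀ ⟨
    Tr 0 ⌈ f ⌉                         ≈⟨ Tr-cong ⨾-idˡ ⟨
    Tr 0 (id m ⨾ ⌈ f ⌉)                ≈⟨ Tr-cong (⨾-cong ⊗-unitˡ ≈-refl) ⟨
    Tr 0 ((id 0 ⊗ id m) ⨾ ⌈ f ⌉)       ∎)

  Form-pre : ∀ {l m n} (c : CCirc l m) {f : SCirc m n} → Form f → Form (⌈ c ⌉ ⨾ f)
  Form-pre {l} {m} c {f} (form {s} {s′} B b k p) = form B b ((id s′ ⊗ c) ⨾ k) (begin
    ⌈ c ⌉ ⨾ f                                          ≈⟨ ⨾-cong ≈-refl p ⟩
    ⌈ c ⌉ ⨾ Tr s ((B ⊗ id m) ⨾ ⌈ k ⌉)                  ≈⟨ tighten ⟩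
    Tr s ((id s ⊗ ⌈ c ⌉) ⨾ (B ⊗ id m) ⨾ ⌈ k ⌉)         ≈⟨ Tr-cong ⨾-assoc ⟨
    Tr s (((id s ⊗ ⌈ c ⌉) ⨾ (B ⊗ id m)) ⨾ ⌈ k ⌉)       ≈⟨ Tr-cong (⨾-cong (split₂ B ⌈ c ⌉) ≈-refl) ⟨
    Tr s ((B ⊗ ⌈ c ⌉) ⨾ ⌈ k ⌉)                         ≈⟨ Tr-cong (⨾-cong (split₁ B ⌈ c ⌉) ≈-refl) ⟩
    Tr s (((B ⊗ id l) ⨾ (id s′ ⊗ ⌈ c ⌉)) ⨾ ⌈ k ⌉)      ≈⟨ Tr-cong ⨾-assoc ⟩
    Tr s ((B ⊗ id l) ⨾ (id s′ ⊗ ⌈ c ⌉) ⨾ ⌈ k ⌉)        ∎)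

  Form-post : ∀ {l m n} {f : SCirc l m} → Form f → (c : CCirc m n) → Form (f ⨾ ⌈ c ⌉)
  Form-post {l} {f = f} (form {s} B b k p) c = form B b (k ⨾ (id s ⊗ c)) (begin
    f ⨾ ⌈ c ⌉                                          ≈⟨ ⨾-cong p ≈-refl ⟩
    Tr s ((B ⊗ id l) ⨾ ⌈ k ⌉) ⨾ ⌈ c ⌉                  ≈⟨ tightenʳ ⟩
    Tr s (((B ⊗ id l) ⨾ ⌈ k ⌉) ⨾ (id s ⊗ ⌈ c ⌉))       ≈⟨ Tr-cong ⨾-assoc ⟩
    Tr s ((B ⊗ id l) ⨾ ⌈ k ⌉ ⨾ (id s ⊗ ⌈ c ⌉))         ∎)

  Form-⊗-id : ∀ {m n} {f : SCirc m n} p → Form f → Form (f ⊗ id p)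
  Form-⊗-id {m} {n} {f} p (form {s} {s′} B b k q) =
    form B b (cast (+-assoc s′ m p) (+-assoc s n p) (k ⊗ id p)) (begin
    f ⊗ id p                                                  ≈⟨ ⊗-cong q ≈-refl ⟩
    Tr s ((B ⊗ id m) ⨾ ⌈ k ⌉) ⊗ id p                          ≈⟨ superposing s ⟨
    Tr s (cast (+-assoc s m p) (+-assoc s n p) (((B ⊗ id m) ⨾ ⌈ k ⌉) ⊗ id p))
      ≈⟨ Tr-cong (begin
         cast (+-assoc s m p) (+-assoc s n p) (((B ⊗ id m) ⨾ ⌈ k ⌉) ⊗ id p) ≈⟨ cast-≈ _ _ _ ⟩
         ((B ⊗ id m) ⨾ ⌈ k ⌉) ⊗ id p                          ≈⟨ ⨾-⊗-id p ⟩
         ((B ⊗ id m) ⊗ id p) ⨾ (⌈ k ⌉ ⊗ id p)                 ≈⟨ ⨾-cong ⊗-assoc (≈-sym (⌈cast⌉ _ _ (k ⊗ id p))) ⟩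
         (B ⊗ (id m ⊗ id p)) ⨾ ⌈ cast (+-assoc s′ m p) (+-assoc s n p) (k ⊗ id p) ⌉
           ≈⟨ ⨾-cong (⊗-cong ≈-refl (⊗-id m p)) ≈-refl ⟩
         (B ⊗ id (m + p)) ⨾ ⌈ cast (+-assoc s′ m p) (+-assoc s n p) (k ⊗ id p) ⌉ ∎) ⟩
    Tr s ((B ⊗ id (m + p)) ⨾ ⌈ cast (+-assoc s′ m p) (+-assoc s n p) (k ⊗ id p) ⌉) ∎)

  Form-id-⊗ : ∀ {m n} {f : SCirc m n} p → Form f → Form (id p ⊗ f)
  Form-id-⊗ {m} {n} {f} p F = Form-resp-≈ (id-⊗-via-swap p f)
    (Form-pre (swap p m) (Form-post (Form-⊗-id p F) (swap n p)))

  -- Vanishing merges the two nested loops into one that carries both families of boxes side by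
  -- side. With `C` a bundle of plain wires this handles traces; with `C` the boxes of a second
  -- circuit it handles composition.
  Form-Tr-⨾ : ∀ {t t′ m n} {C : SCirc t t′} {f : SCirc (t′ + m) (t + n)} →
              Boxes C → Form f → Form (Tr t {m} {n} ((C ⊗ id m) ⨾ f))
  Form-Tr-⨾ {t} {t′} {m} {n} {C} {f} c (form {s} {s′} B b k q) =
    form (B ⊗ C) (Boxes-⊗ b c) (cast (sym (+-assoc s′ t′ m)) (sym (+-assoc s t n)) k) (begin
    Tr t ((C ⊗ id m) ⨾ f)                                      ≈⟨ Tr-cong (⨾-cong ≈-refl q) ⟩
    Tr t ((C ⊗ id m) ⨾ Tr s ((B ⊗ id (t′ + m)) ⨾ ⌈ k ⌉))       ≈⟨ Tr-cong tighten ⟩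
    Tr t (Tr s ((id s ⊗ (C ⊗ id m)) ⨾ (B ⊗ id (t′ + m)) ⨾ ⌈ k ⌉)) ≈⟨ vanishing₊ s t ⟨
    Tr (s + t) (cast (sym (+-assoc s t m)) (sym (+-assoc s t n))
      ((id s ⊗ (C ⊗ id m)) ⨾ (B ⊗ id (t′ + m)) ⨾ ⌈ k ⌉))
      ≈⟨ Tr-cong (begin
        cast (sym (+-assoc s t m)) (sym (+-assoc s t n)) ((id s ⊗ (C ⊗ id m)) ⨾ (B ⊗ id (t′ + m)) ⨾ ⌈ k ⌉)
                                                               ≈⟨ cast-≈ _ _ _ ⟩
        (id s ⊗ (C ⊗ id m)) ⨾ (B ⊗ id (t′ + m)) ⨾ ⌈ k ⌉        ≈⟨ ⨾-assoc ⟨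
        ((id s ⊗ (C ⊗ id m)) ⨾ (B ⊗ id (t′ + m))) ⨾ ⌈ k ⌉      ≈⟨ ⨾-cong (split₂ B (C ⊗ id m)) ≈-refl ⟨
        (B ⊗ (C ⊗ id m)) ⨾ ⌈ k ⌉                               ≈⟨ ⨾-cong ⊗-assoc (⌈cast⌉ _ _ k) ⟨
        ((B ⊗ C) ⊗ id m) ⨾ ⌈ cast (sym (+-assoc s′ t′ m)) (sym (+-assoc s t n)) k ⌉ ∎) ⟩
    Tr (s + t) (((B ⊗ C) ⊗ id m) ⨾ ⌈ cast (sym (+-assoc s′ t′ m)) (sym (+-assoc s t n)) k ⌉) ∎)

  Form-Tr : ∀ {x m n} {f : SCirc (x + m) (x + n)} → Form f → Form (Tr x {m} {n} f)
  Form-Tr {x} {m} F = Form-resp-≈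
    (Tr-cong (≈-trans (≈-sym ⨾-idˡ) (⨾-cong (≈-sym (⊗-id x m)) ≈-refl)))
    (Form-Tr-⨾ (Boxes-id x) F)

  -- Tightening draws `f` into the loop of `g`, where it slides past the boxes of `g`. The rest of
  -- the loop body, `f` beside wires followed by a combinational core, again has a form, so the two
  -- loops can be merged.
  Form-⨾ : ∀ {l m n} {f : SCirc l m} {g : SCirc m n} → Form f → Form g → Form (f ⨾ g)
  Form-⨾ {l} {m} {n} {f} {g} F (form {s} {s′} B b k q) = Form-resp-≈
    (begin
    f ⨾ g                                              ≈⟨ ⨾-cong ≈-refl q ⟩
    f ⨾ Tr s ((B ⊗ id m) ⨾ ⌈ k ⌉)                      ≈⟨ tighten ⟩
    Tr s ((id s ⊗ f) ⨾ (B ⊗ id m) ⨾ ⌈ k ⌉)             ≈⟨ Tr-cong ⨾-assoc ⟨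
    Tr s (((id s ⊗ f) ⨾ (B ⊗ id m)) ⨾ ⌈ k ⌉)           ≈⟨ Tr-cong (⨾-cong (split₂ B f) ≈-refl) ⟨
    Tr s ((B ⊗ f) ⨾ ⌈ k ⌉)                             ≈⟨ Tr-cong (⨾-cong (split₁ B f) ≈-refl) ⟩
    Tr s (((B ⊗ id l) ⨾ (id s′ ⊗ f)) ⨾ ⌈ k ⌉)          ≈⟨ Tr-cong ⨾-assoc ⟩
    Tr s ((B ⊗ id l) ⨾ (id s′ ⊗ f) ⨾ ⌈ k ⌉)            ∎)
    (Form-Tr-⨾ b (Form-post (Form-id-⊗ s′ F) k))

  -- Yanking introduces a loop on the input wires of the box, and naturality of the swap moves the
  -- box onto that loop.
  Form-box : ∀ {m n} {B : SCirc m n} → Boxes B → Form B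
  Form-box {m} {n} {B} b = form B b (swap n m) (begin
    B                                                  ≈⟨ ⨾-idˡ ⟨
    id m ⨾ B                                           ≈⟨ ⨾-cong (yanking m) ≈-refl ⟨
    Tr m (swap m m) ⨾ B                                ≈⟨ tightenʳ ⟩
    Tr m (swap m m ⨾ (id m ⊗ B))                       ≈⟨ Tr-cong swap-natural ⟨
    Tr m ((B ⊗ id m) ⨾ swap n m)                       ∎)

  normalise : ∀ {m n} (f : SCirc m n) → Form f
  normalise (prim p)    = Form-comb (prim p)
  normalise fork        = Form-comb fork
  normalise join        = Form-comb join
  normalise intro       = Form-comb intro
  normalise elim        = Form-comb elim
  normalise (id n)      = Form-comb (id n)
  normalise (swap m n)  = Form-comb (swap m n)
  normalise (f ⨾ g)     = Form-⨾ (normalise f) (normalise g)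
  normalise (_⊗_ {n = n} {m′ = m′} f g) = Form-resp-≈ (split₁ f g)
    (Form-⨾ (Form-⊗-id m′ (normalise f)) (Form-id-⊗ n (normalise g)))
  normalise (val v v≢•) = Form-box (Boxes-val v v≢•)
  normalise delay       = Form-box Boxes-delay
  normalise (Tr x f)    = Form-Tr (normalise f)

  record GlobalTraceDelay {m n} (f : SCirc m n) : Set where
    constructor globalTraceDelay
    field
      x y {z} : ℕ
      initial : Vec Value z
      core    : CCirc (x + (y + (z + m))) (x + (y + n))
      eq      : f ≈ Tr (x + y) {m} {n}
                  (cast (sym (+-assoc x y m)) (sym (+-assoc x y n))
                    ((id x ⊗ (delays y ⊗ (values initial ⊗ id m))) ⨾ ⌈ core ⌉))

  -- Both rewirings vanish into the core: `Q` already stands in front of it, and `P`, at the start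
  -- of the loop, is carried round to its end by sliding.
  traceDelayForm : ∀ {m n} (f : SCirc m n) → GlobalTraceDelay f
  traceDelayForm {m} {n} f
    with form {s} {s′} B (x , y , z , v , P , Q , p) k q ← normalise f
    = globalTraceDelay x y v k̂ (begin
    f                                                        ≈⟨ q ⟩
    Tr s ((B ⊗ id m) ⨾ ⌈ k ⌉)
      ≈⟨ Tr-cong (⨾-cong (⊗-cong p ≈-refl) ≈-refl) ⟩
    Tr s (((⌈ P ⌉ ⨾ N ⨾ ⌈ Q ⌉) ⊗ id m) ⨾ ⌈ k ⌉)
      ≈⟨ Tr-cong (≈-trans (⨾-cong (⨾-⊗-id m) ≈-refl) ⨾-assoc) ⟩
    Tr s ((⌈ P ⌉ ⊗ id m) ⨾ ((N ⨾ ⌈ Q ⌉) ⊗ id m) ⨾ ⌈ k ⌉)     ≈⟨ sliding ⟨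
    Tr (x + (y + 0)) ((((N ⨾ ⌈ Q ⌉) ⊗ id m) ⨾ ⌈ k ⌉) ⨾ (⌈ P ⌉ ⊗ id n))
      ≈⟨ Tr-≡ x+y+0 body ⟩
    Tr (x + y) (cast (sym (+-assoc x y m)) (sym (+-assoc x y n))
      ((id x ⊗ (delays y ⊗ (values v ⊗ id m))) ⨾ ⌈ k̂ ⌉))     ∎)
    where
    N = id x ⊗ (delays y ⊗ values v)
    -- The 0 counts the inputs of the values: after sliding, the loop consists of the inputs of the
    -- sorted boxes.
    x+y+0 : x + (y + 0) ≡ x + y
    x+y+0 = cong (x +_) (+-identityʳ y)
    k̃ : CCirc ((x + (y + z)) + m) ((x + (y + 0)) + n)
    k̃ = (Q ⊗ id m) ⨾ k ⨾ (P ⊗ id n)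
    e₁ : (x + (y + z)) + m ≡ x + (y + (z + m))
    e₁ = trans (+-assoc x (y + z) m) (cong (x +_) (+-assoc y z m))
    e₂ : (x + (y + 0)) + n ≡ x + (y + n)
    e₂ = trans (cong (_+ n) x+y+0) (+-assoc x y n)
    k̂ : CCirc (x + (y + (z + m))) (x + (y + n))
    k̂ = cast e₁ e₂ k̃
    Tr-≡ : ∀ {s t m n} → s ≡ t → {f : SCirc (s + m) (s + n)} {g : SCirc (t + m) (t + n)} →
           f ≈ g → Tr s f ≈ Tr t g
    Tr-≡ refl = Tr-cong
    body : (((N ⨾ ⌈ Q ⌉) ⊗ id m) ⨾ ⌈ k ⌉) ⨾ (⌈ P ⌉ ⊗ id n) ≈
           cast (sym (+-assoc x y m)) (sym (+-assoc x y n))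
             ((id x ⊗ (delays y ⊗ (values v ⊗ id m))) ⨾ ⌈ k̂ ⌉)
    body = begin
      (((N ⨾ ⌈ Q ⌉) ⊗ id m) ⨾ ⌈ k ⌉) ⨾ (⌈ P ⌉ ⊗ id n)        ≈⟨ ⨾-assoc ⟩
      ((N ⨾ ⌈ Q ⌉) ⊗ id m) ⨾ ⌈ k ⌉ ⨾ (⌈ P ⌉ ⊗ id n)          ≈⟨ ⨾-cong (⨾-⊗-id m) ≈-refl ⟩
      ((N ⊗ id m) ⨾ (⌈ Q ⌉ ⊗ id m)) ⨾ ⌈ k ⌉ ⨾ (⌈ P ⌉ ⊗ id n) ≈⟨ ⨾-assoc ⟩
      (N ⊗ id m) ⨾ ⌈ k̃ ⌉
        ≈⟨ ⨾-cong (≈-trans ⊗-assoc (⊗-cong ≈-refl ⊗-assoc)) (≈-sym (⌈cast⌉ e₁ e₂ k̃)) ⟩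
      (id x ⊗ (delays y ⊗ (values v ⊗ id m))) ⨾ ⌈ k̂ ⌉        ≈⟨ cast-≈ _ _ _ ⟨
      cast (sym (+-assoc x y m)) (sym (+-assoc x y n))
        ((id x ⊗ (delays y ⊗ (values v ⊗ id m))) ⨾ ⌈ k̂ ⌉)   ∎

  -- Registers

  reg₁ : Value → SCirc 1 1
  reg₁ v = (value v ⊗ delay) ⨾ join

  -- The shuffle inside `joins` undoes the grouping of values before delays. Since values have no
  -- inputs, moving a delay past them costs only `swap 0 1`, an identity.
  reg-∷ : ∀ {n} v (vs : Vec Value n) → reg (v ∷ vs) ≈ reg₁ v ⊗ reg vs
  reg-∷ {n} v vs = begin
    ((value v ⊗ values vs) ⊗ (delay ⊗ delays n)) ⨾ ((id 1 ⊗ shuffle) ⨾ (join ⊗ joins n))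
      ≈⟨ ⨾-assoc ⟨
    (((value v ⊗ values vs) ⊗ (delay ⊗ delays n)) ⨾ (id 1 ⊗ shuffle)) ⨾ (join ⊗ joins n)
      ≈⟨ ⨾-cong reorder ≈-refl ⟩
    ((value v ⊗ delay) ⊗ (values vs ⊗ delays n)) ⨾ (join ⊗ joins n)
      ≈⟨ ⊗-⨾-⊗ ⟩
    reg₁ v ⊗ reg vs ∎
    where
    shuffle = cast (+-assoc n 1 n) refl (swap n 1 ⊗ id n)
    past : (values vs ⊗ delay) ⨾ swap n 1 ≈ delay ⊗ values vs
    past = ≈-trans swap-natural (≈-trans (⨾-cong (swap-unitˡ 1) ≈-refl) ⨾-idˡ)
    reorder : ((value v ⊗ values vs) ⊗ (delay ⊗ delays n)) ⨾ (id 1 ⊗ shuffle) ≈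
              (value v ⊗ delay) ⊗ (values vs ⊗ delays n)
    reorder = begin
      ((value v ⊗ values vs) ⊗ (delay ⊗ delays n)) ⨾ (id 1 ⊗ shuffle)
        ≈⟨ ⨾-cong (≈-trans ⊗-assoc (⊗-cong ≈-refl (≈-sym ⊗-assoc))) (⊗-cong ≈-refl (cast-≈ _ _ _)) ⟩
      (value v ⊗ ((values vs ⊗ delay) ⊗ delays n)) ⨾ (id 1 ⊗ (swap n 1 ⊗ id n))
        ≈⟨ ≈-trans ⊗-⨾-⊗ (⊗-cong ⨾-idʳ ⊗-⨾-⊗) ⟩
      value v ⊗ (((values vs ⊗ delay) ⨾ swap n 1) ⊗ (delays n ⨾ id n))
        ≈⟨ ⊗-cong ≈-refl (⊗-cong past ⨾-idʳ) ⟩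
      value v ⊗ ((delay ⊗ values vs) ⊗ delays n)
        ≈⟨ ≈-trans (⊗-cong ≈-refl ⊗-assoc) (≈-sym ⊗-assoc) ⟩
      (value v ⊗ delay) ⊗ (values vs ⊗ delays n) ∎

  reg-++ : ∀ {m n} (u : Vec Value m) (v : Vec Value n) → reg (u ++ v) ≈ reg u ⊗ reg v
  reg-++ [] v = begin
    reg v                          ≈⟨ ⊗-unitˡ ⟨
    id 0 ⊗ reg v                   ≈⟨ ⊗-cong (≈-trans (⨾-cong ⊗-unitˡ ≈-refl) ⨾-idʳ) ≈-refl ⟨
    reg [] ⊗ reg v                 ∎
  reg-++ (a ∷ u) v = begin
    reg (a ∷ (u ++ v))             ≈⟨ reg-∷ a (u ++ v) ⟩
    reg₁ a ⊗ reg (u ++ v)          ≈⟨ ⊗-cong ≈-refl (reg-++ u v) ⟩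
    reg₁ a ⊗ (reg u ⊗ reg v)       ≈⟨ ⊗-assoc ⟨
    (reg₁ a ⊗ reg u) ⊗ reg v       ≈⟨ ⊗-cong (reg-∷ a u) ≈-refl ⟨
    reg (a ∷ u) ⊗ reg v            ∎

  -- The left side is the shape in which (Str) leaves a circuit once its values are evaluated; the
  -- right side is the shape that productivity asks for.
  ⨾-reg : ∀ {m n} (f : SCirc m n) (v : Vec Value n) →
          (values v ⊗ (f ⨾ delays n)) ⨾ joins n ≈ f ⨾ reg v
  ⨾-reg {n = n} f v = begin
    (values v ⊗ (f ⨾ delays n)) ⨾ joins n            ≈⟨ ⨾-cong (⊗-cong ⨾-idˡ ≈-refl) ≈-refl ⟨
    ((id 0 ⨾ values v) ⊗ (f ⨾ delays n)) ⨾ joins n   ≈⟨ ⨾-cong interchange ≈-refl ⟩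
    ((id 0 ⊗ f) ⨾ (values v ⊗ delays n)) ⨾ joins n   ≈⟨ ⨾-cong (⨾-cong ⊗-unitˡ ≈-refl) ≈-refl ⟩
    (f ⨾ (values v ⊗ delays n)) ⨾ joins n            ≈⟨ ⨾-assoc ⟩
    f ⨾ reg v                                        ∎

  value-• : value • ≈ intro
  value-• with • ≟ •
  ... | yes _  = ≈-refl
  ... | no •≢• = ⊥-elim (•≢• refl)

  ⌈elims⌉ : ∀ n → ⌈ elims n ⌉ ≡ elims n
  ⌈elims⌉ zero    = refl
  ⌈elims⌉ (suc n) = cong (elim ⊗_) (⌈elims⌉ n)

  ⌈intros⌉ : ∀ n → ⌈ intros n ⌉ ≡ intros n
  ⌈intros⌉ zero    = refl
  ⌈intros⌉ (suc n) = cong (intro ⊗_) (⌈intros⌉ n)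

  -- Reduction modulo the axioms

  infix 4 _⊢_⇝_
  infixr 5 _◃_
  -- `Star` cannot record a use of the axioms when no rule fires, as happens for identities and
  -- swaps; `done` can.
  data _⊢_⇝_ (R : CircuitRel) {m n} : SCirc m n → SCirc m n → Set where
    done : ∀ {f g} → f ≈ g → R ⊢ f ⇝ g
    _◃_  : ∀ {f g h} → Step R f g → R ⊢ g ⇝ h → R ⊢ f ⇝ h

  module _ {R : CircuitRel} where

    ⇝-≈ˡ : ∀ {m n} {f g h : SCirc m n} → f ≈ g → R ⊢ g ⇝ h → R ⊢ f ⇝ h
    ⇝-≈ˡ p (done q) = done (≈-trans p q)
    ⇝-≈ˡ p (s ◃ r)  = modulo p s ≈-refl ◃ r

    ⇝-trans : ∀ {m n} {f g h : SCirc m n} → R ⊢ f ⇝ g → R ⊢ g ⇝ h → R ⊢ f ⇝ h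
    ⇝-trans (done p) r′ = ⇝-≈ˡ p r′
    ⇝-trans (s ◃ r)  r′ = s ◃ ⇝-trans r r′

    ⇝-≈ʳ : ∀ {m n} {f g h : SCirc m n} → R ⊢ f ⇝ g → g ≈ h → R ⊢ f ⇝ h
    ⇝-≈ʳ r p = ⇝-trans r (done p)

    ⇝-map : ∀ {m n m′ n′} (C : SCirc m n → SCirc m′ n′) →
            (∀ {f g} → f ≈ g → C f ≈ C g) →
            (∀ {f g} → Step R f g → Step R (C f) (C g)) →
            ∀ {f g} → R ⊢ f ⇝ g → R ⊢ C f ⇝ C g
    ⇝-map C C-≈ C-step (done p) = done (C-≈ p)
    ⇝-map C C-≈ C-step (s ◃ r)  = C-step s ◃ ⇝-map C C-≈ C-step r

    ⇝-⨾ˡ : ∀ {l m n} {f g : SCirc l m} {h : SCirc m n} → R ⊢ f ⇝ g → R ⊢ f ⨾ h ⇝ g ⨾ h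
    ⇝-⨾ˡ {h = h} = ⇝-map (_⨾ h) (λ p → ⨾-cong p ≈-refl) ⨾-left

    ⇝-⊗ : ∀ {m n p q} {f g : SCirc m n} {f′ g′ : SCirc p q} →
          R ⊢ f ⇝ g → R ⊢ f′ ⇝ g′ → R ⊢ f ⊗ f′ ⇝ g ⊗ g′
    ⇝-⊗ {g = g} {f′} r r′ =
      ⇝-trans (⇝-map (_⊗ f′) (λ p → ⊗-cong p ≈-refl) ⊗-left r)
              (⇝-map (g ⊗_) (λ p → ⊗-cong ≈-refl p) ⊗-right r′)

    -- Each equation is absorbed by the step before it through `modulo`. An equation with no step
    -- before it is moved to the front, to be absorbed by whatever precedes the sequence.
    ⇝⇒Star : ∀ {m n} {f g : SCirc m n} → R ⊢ f ⇝ g →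
              ∃[ f′ ] f ≈ f′ × Star (Step R {m} {n}) f′ g
    ⇝⇒Star (done p) = _ , p , ε
    ⇝⇒Star (s ◃ r) with ⇝⇒Star r
    ... | _ , p , ss = _ , ≈-refl , modulo ≈-refl s p ◅ ss

module Adequacy (S : Signature) (I : Interpretation S) where
  open Signature S
  open Interpretation I
  open Circuits S
  open Semantics S I
  open StreamFun
  open LeastFixedPoint using (lfp; lfp-fixed; lfp-induction)
  open IsLattice isLattice using (x≤x∨y; y≤x∨y; ∨-least; antisym)
    renaming (refl to ⊑-refl)
  open NormalForms S

  -- Soundness of the axioms

  -- Equality of streams of vectors whose lengths are equal only propositionally.
  infix 4 _≋_
  _≋_ : ∀ {m n} → Stream m → Stream n → Set
  σ ≋ τ = ∀ t → toList (σ t) ≡ toList (τ t)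

  apply-cong : ∀ {m n} (F : StreamFun m n) {σ τ : Stream m} →
               (∀ t → σ t ≡ τ t) → ∀ t → apply F σ t ≡ apply F τ t
  apply-cong F σ≡τ t = causal F t (λ _ → σ≡τ _)

  ≋-apply : ∀ {m n} (F : StreamFun m n) {σ τ : Stream m} → σ ≋ τ → apply F σ ≋ apply F τ
  ≋-apply F σ≋τ t = cong toList (apply-cong F (λ s → toList-inj (σ≋τ s)) t)

  -- Each least fixed point is a fixed point of the other feedback map, so each lies below the
  -- other. The outer arities may differ, as they do in tightening and superposing.
  feedback-cong : ∀ {x m m′ n n′} (F : StreamFun (x + m) (x + n)) (G : StreamFun (x + m′) (x + n′)) {σ σ′} →
    (∀ ρ t → take x (apply F (ρ ++ˢ σ) t) ≡ take x (apply G (ρ ++ˢ σ′) t)) →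
    ∀ t → lfp (feedback x F σ) t ≡ lfp (feedback x G σ′) t
  feedback-cong {x} F G {σ} {σ′} eq t = ⊑ᵛ-antisym
    (lfp-induction (feedback x F σ) (λ s → ⊑ᵛ-reflexive
      (trans (eq _ s) (lfp-fixed (feedback x G σ′) s))) t)
    (lfp-induction (feedback x G σ′) (λ s → ⊑ᵛ-reflexive
      (trans (sym (eq _ s)) (lfp-fixed (feedback x F σ) s))) t)

  module _ {x m n : ℕ} (F : StreamFun (x + m) (x + n)) (σ : Stream m) where

    -- Least pre-fixed points are unique. A trace can thus be computed from any explicit candidate,
    -- without looking at the iterates that define `lfp`.
    trace-at : (τ : Stream x) →
               (∀ t → take x (apply F (τ ++ˢ σ) t) ≡ τ t) →
               (∀ ρ → (∀ t → take x (apply F (ρ ++ˢ σ) t) ⊑ᵛ ρ t) → τ ⊑ˢ ρ) →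
               ∀ t → apply (traceˢ x F) σ t ≡ drop x (apply F (τ ++ˢ σ) t)
    trace-at τ fixed least t = cong (drop x) (apply-cong F (λ s → cong (_++ σ s) (μ≡τ s)) t)
      where
      μ≡τ : ∀ s → lfp (feedback x F σ) s ≡ τ s
      μ≡τ s = ⊑ᵛ-antisym (lfp-induction (feedback x F σ) (λ r → ⊑ᵛ-reflexive (fixed r)) s)
        (least _ (λ r → ⊑ᵛ-reflexive (lfp-fixed (feedback x F σ) r)) s)

  trace-cong : ∀ {x m n} {F G : StreamFun (x + m) (x + n)} → F ≗ˢ G → traceˢ x F ≗ˢ traceˢ x G
  trace-cong {x} {F = F} {G} eq σ t = cong (drop x) (trans (eq _ t)
    (apply-cong G (λ s → cong (_++ σ s) (feedback-cong F G (λ ρ r → cong (take x) (eq _ r)) s)) t))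

  -- Like its companions below, this keeps the traced composite abstract as `K` and describes it by
  -- an equation, so that the fixed-point argument is free of the bookkeeping of `take` and `drop`.
  trace-tightening : ∀ {x l m n k} (G : StreamFun l m) (F : StreamFun (x + m) (x + n)) (H : StreamFun n k)
    (K : StreamFun (x + l) (x + k)) →
    (∀ ρ σ t → apply K (ρ ++ˢ σ) t ≡
               take x (apply F (ρ ++ˢ apply G σ) t) ++ apply H (dropˢ x (apply F (ρ ++ˢ apply G σ))) t) →
    traceˢ x K ≗ˢ composeˢ G (composeˢ (traceˢ x F) H)
  trace-tightening {x} G F H K K-eq σ t =
    trans (cong (drop x) (K-eq _ σ t))
    (trans (drop-++ {m = x} _ _)
    (apply-cong H (λ s → cong (drop x) (apply-cong F (λ r → cong (_++ apply G σ r)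
      (feedback-cong K F (λ ρ s → trans (cong (take x) (K-eq ρ σ s)) (take-++ {m = x} _ _)) r)) s)) t))

  -- This is the rolling rule for least fixed points: if `θ` is least for one order of the two maps
  -- round the loop, its image under `G` is least for the other order.
  trace-sliding : ∀ {x y m n} (F : StreamFun (x + m) (y + n)) (G : StreamFun y x)
    (A : StreamFun (x + m) (x + n)) (B : StreamFun (y + m) (y + n)) →
    (∀ ρ t → apply A ρ t ≡ apply G (takeˢ y (apply F ρ)) t ++ drop y (apply F ρ t)) →
    (∀ θ σ t → apply B (θ ++ˢ σ) t ≡ apply F (apply G θ ++ˢ σ) t) →
    traceˢ x A ≗ˢ traceˢ y B
  trace-sliding {x} {y} F G A B A-eq B-eq σ t =
    trans (trace-at A σ (apply G θ) fixed least t)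
    (trans (cong (drop x) (A-eq _ t))
    (trans (drop-++ {m = x} _ _)
    (sym (cong (drop y) (B-eq θ σ t)))))
    where
    θ : Stream y
    θ = lfp (feedback y B σ)
    θ-fixed : ∀ s → take y (apply F (apply G θ ++ˢ σ) s) ≡ θ s
    θ-fixed s = trans (sym (cong (take y) (B-eq θ σ s))) (lfp-fixed (feedback y B σ) s)
    A-take : ∀ ρ s → take x (apply A ρ s) ≡ apply G (takeˢ y (apply F ρ)) s
    A-take ρ s = trans (cong (take x) (A-eq ρ s)) (take-++ {m = x} _ _)
    fixed : ∀ s → take x (apply A (apply G θ ++ˢ σ) s) ≡ apply G θ s
    fixed s = trans (A-take _ s) (apply-cong G θ-fixed s)
    least : ∀ ρ → (∀ s → take x (apply A (ρ ++ˢ σ) s) ⊑ᵛ ρ s) → apply G θ ⊑ˢ ρ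
    least ρ pre s = ⊑ᵛ-trans (mono G θ⊑θ′ s) (Gθ′⊑ρ s)
      where
      θ′ : Stream y
      θ′ = takeˢ y (apply F (ρ ++ˢ σ))
      Gθ′⊑ρ : apply G θ′ ⊑ˢ ρ
      Gθ′⊑ρ r = subst (_⊑ᵛ ρ r) (A-take _ r) (pre r)
      θ⊑θ′ : θ ⊑ˢ θ′
      θ⊑θ′ = lfp-induction (feedback y B σ) (λ r → subst (_⊑ᵛ θ′ r)
        (sym (cong (take y) (B-eq θ′ σ r)))
        (take-mono y (mono F (λ q → Pointwise.++⁺ (Gθ′⊑ρ q) ⊑ᵛ-refl) r)))

  lfp-mono : ∀ {x m n} (F : StreamFun (x + m) (x + n)) {σ τ} → σ ⊑ˢ τ →
             lfp (feedback x F σ) ⊑ˢ lfp (feedback x F τ)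
  lfp-mono {x} F {σ} {τ} σ⊑τ = lfp-induction (feedback x F σ) (λ t → ⊑ᵛ-trans
    (take-mono x (mono F (λ s → Pointwise.++⁺ ⊑ᵛ-refl (σ⊑τ s)) t))
    (⊑ᵛ-reflexive (lfp-fixed (feedback x F τ) t)))

  -- Bekić's lemma.
  trace-vanishing : ∀ {x y m n} (F : StreamFun (x + (y + m)) (x + (y + n)))
    (K : StreamFun ((x + y) + m) ((x + y) + n)) →
    (∀ {σ τ} → σ ≋ τ → apply K σ ≋ apply F τ) →
    traceˢ (x + y) K ≗ˢ traceˢ y (traceˢ x F)
  trace-vanishing {x} {y} F K K-eq σ t =
    trans (trace-at K σ (α ++ˢ β) fixed least t)
          (drop-+ x y _ _ (K-eq (split α β) t))
    where
    β : Stream y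
    β = lfp (feedback y (traceˢ x F) σ)
    α : Stream x
    α = lfp (feedback x F (β ++ˢ σ))
    split : ∀ (a : Stream x) (b : Stream y) → (a ++ˢ b) ++ˢ σ ≋ a ++ˢ (b ++ˢ σ)
    split a b s = toList-++-assoc (a s) (b s) (σ s)
    K-take : ∀ a b s → take x (take (x + y) (apply K ((a ++ˢ b) ++ˢ σ) s)) ≡ take x (apply F (a ++ˢ (b ++ˢ σ)) s)
    K-take a b s = take-take x y _ _ (K-eq (split a b) s)
    K-drop : ∀ a b s → drop x (take (x + y) (apply K ((a ++ˢ b) ++ˢ σ) s)) ≡ take y (drop x (apply F (a ++ˢ (b ++ˢ σ)) s))
    K-drop a b s = drop-take x y _ _ (K-eq (split a b) s)
    fixed : ∀ s → take (x + y) (apply K ((α ++ˢ β) ++ˢ σ) s) ≡ (α ++ˢ β) s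
    fixed s = trans (sym (take++drop≡id x _)) (cong₂ _++_
      (trans (K-take α β s) (lfp-fixed (feedback x F (β ++ˢ σ)) s))
      (trans (K-drop α β s) (lfp-fixed (feedback y (traceˢ x F) σ) s)))
    least : ∀ ρ → (∀ s → take (x + y) (apply K (ρ ++ˢ σ) s) ⊑ᵛ ρ s) → α ++ˢ β ⊑ˢ ρ
    least ρ pre s = subst ((α ++ˢ β) s ⊑ᵛ_) (take++drop≡id x (ρ s)) (Pointwise.++⁺ (α⊑a s) (β⊑b s))
      where
      a = takeˢ x ρ
      b = dropˢ x ρ
      pre′ : ∀ s → take (x + y) (apply K ((a ++ˢ b) ++ˢ σ) s) ⊑ᵛ ρ s
      pre′ s = ⊑ᵛ-trans (⊑ᵛ-reflexive (cong (take (x + y))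
        (apply-cong K (λ r → cong (_++ σ r) (take++drop≡id x (ρ r))) s))) (pre s)
      pre-a : ∀ s → take x (apply F (a ++ˢ (b ++ˢ σ)) s) ⊑ᵛ a s
      pre-a s = subst (_⊑ᵛ a s) (K-take a b s) (take-mono x (pre′ s))
      pre-b : ∀ s → take y (drop x (apply F (a ++ˢ (b ++ˢ σ)) s)) ⊑ᵛ b s
      pre-b s = subst (_⊑ᵛ b s) (K-drop a b s) (drop-mono x (pre′ s))
      -- The inner fixed point is first taken at `b`, since `β ⊑ˢ b` is not yet available;
      -- afterwards monotonicity carries the bound over to `α`.
      α′⊑a : lfp (feedback x F (b ++ˢ σ)) ⊑ˢ a
      α′⊑a = lfp-induction (feedback x F (b ++ˢ σ)) pre-a
      β⊑b : β ⊑ˢ b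
      β⊑b = lfp-induction (feedback y (traceˢ x F) σ) (λ s → ⊑ᵛ-trans
        (take-mono y (drop-mono x (mono F (λ r → Pointwise.++⁺ (α′⊑a r) ⊑ᵛ-refl) s)))
        (pre-b s))
      α⊑a : α ⊑ˢ a
      α⊑a r = ⊑ᵛ-trans (lfp-mono F (λ q → Pointwise.++⁺ (β⊑b q) ⊑ᵛ-refl) r) (α′⊑a r)

  trace-superposing : ∀ {x m n p q} (F : StreamFun (x + m) (x + n)) (G : StreamFun p q)
    (K : StreamFun (x + (m + p)) (x + (n + q))) →
    (∀ {σ τ} → σ ≋ τ → apply (tensorˢ F G) σ ≋ apply K τ) →
    traceˢ x K ≗ˢ tensorˢ (traceˢ x F) G
  trace-superposing {x} {m} {n} {p} F G K K-eq σ t =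
    trans (cong (drop x) (K-≡ _ t))
    (trans (drop-++ (take x (apply F (in₁ (lfp (feedback x K σ))) t)) _)
    (cong (λ v → drop x v ++ apply G (dropˢ m σ) t)
      (apply-cong F (λ s → cong (_++ take m (σ s))
        (feedback-cong K F (λ ρ r → trans (cong (take x) (K-≡ ρ r)) (take-++ {m = x} _ _)) s)) t)))
    where
    module _ (ρ : Stream x) where
      in₁ : Stream (x + m)
      in₁ = ρ ++ˢ takeˢ m σ
      in₂ : Stream ((x + m) + p)
      in₂ = in₁ ++ˢ dropˢ m σ
      in≋ : in₂ ≋ ρ ++ˢ σ
      in≋ s = trans (toList-++-assoc (ρ s) (take m (σ s)) (drop m (σ s)))
        (cong (λ v → toList (ρ s ++ v)) (take++drop≡id m (σ s)))
      K-≡ : ∀ t → apply K (ρ ++ˢ σ) t ≡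
            take x (apply F in₁ t) ++ (drop x (apply F in₁ t) ++ apply G (dropˢ m σ) t)
      K-≡ t = toList-inj (trans (sym (K-eq in≋ t))
        (trans (cong toList (cong₂ _++_
          (trans (apply-cong F (λ s → take-++ (in₁ s) _) t) (sym (take++drop≡id x _)))
          (apply-cong G (λ s → drop-++ (in₁ s) _) t)))
        (toList-++-assoc (take x (apply F in₁ t)) _ _)))

  infix 4 _≃_
  -- The arity equations are part of soundness because `≈` is heterogeneous: the congruence cases
  -- for tensor and trace must split both sides at the same place.
  record _≃_ {m n m′ n′} (f : SCirc m n) (g : SCirc m′ n′) : Set where
    constructor sound
    field
      dom-≡   : m ≡ m′
      cod-≡   : n ≡ n′
      ⟦⟧-resp : ∀ {σ τ} → σ ≋ τ → apply ⟦ f ⟧ˢ σ ≋ apply ⟦ g ⟧ˢ τ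

  ≗⇒≃ : ∀ {m n} {f g : SCirc m n} → ⟦ f ⟧ˢ ≗ˢ ⟦ g ⟧ˢ → f ≃ g
  ≗⇒≃ {f = f} eq = sound refl refl λ {_} {τ} σ≋τ t →
    trans (≋-apply ⟦ f ⟧ˢ σ≋τ t) (cong toList (eq τ t))

  ≃⇒≗ : ∀ {m n} {f g : SCirc m n} → f ≃ g → ⟦ f ⟧ˢ ≗ˢ ⟦ g ⟧ˢ
  ≃⇒≗ (sound _ _ eq) σ t = toList-inj (eq (λ _ → refl) t)

  ≃-refl : ∀ {m n} {f : SCirc m n} → f ≃ f
  ≃-refl {f = f} = ≗⇒≃ {f = f} {f} (λ _ _ → refl)

  ≃-sym : ∀ {m n m′ n′} {f : SCirc m n} {g : SCirc m′ n′} → f ≃ g → g ≃ f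
  ≃-sym (sound p q eq) = sound (sym p) (sym q) λ σ≋τ t → sym (eq (λ s → sym (σ≋τ s)) t)

  ≃-trans : ∀ {m n m′ n′ m″ n″} {f : SCirc m n} {g : SCirc m′ n′} {h : SCirc m″ n″} →
            f ≃ g → g ≃ h → f ≃ h
  ≃-trans (sound refl q eq) (sound p′ q′ eq′) =
    sound p′ (trans q q′) λ σ≋τ t → trans (eq (λ _ → refl) t) (eq′ σ≋τ t)

  ≃-⨾ : ∀ {l m n l′ m′ n′} {f : SCirc l m} {f′ : SCirc l′ m′} {g : SCirc m n} {g′ : SCirc m′ n′} →
        f ≃ f′ → g ≃ g′ → f ⨾ g ≃ f′ ⨾ g′
  ≃-⨾ (sound p q eq) (sound p′ q′ eq′) = sound p q′ λ σ≋τ → eq′ (eq σ≋τ)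

  ≃-⊗ : ∀ {m n m′ n′ p q p′ q′} {f : SCirc m n} {f′ : SCirc m′ n′} {g : SCirc p q} {g′ : SCirc p′ q′} →
        f ≃ f′ → g ≃ g′ → f ⊗ g ≃ f′ ⊗ g′
  ≃-⊗ {m} {f = f} {f′} {g} {g′} a@(sound refl refl _) b@(sound refl refl _) =
    ≗⇒≃ {f = f ⊗ g} {f′ ⊗ g′} λ σ t → cong₂ _++_ (≃⇒≗ a (takeˢ m σ) t) (≃⇒≗ b (dropˢ m σ) t)

  ≃-Tr : ∀ {x m n m′ n′} {f : SCirc (x + m) (x + n)} {f′ : SCirc (x + m′) (x + n′)} →
         f ≃ f′ → Tr x {m} {n} f ≃ Tr x {m′} {n′} f′
  ≃-Tr {x} {m} {n} {m′} {n′} {f} {f′} e@(sound p q _)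
    with refl ← +-cancelˡ-≡ x m m′ p | refl ← +-cancelˡ-≡ x n n′ q =
    ≗⇒≃ {f = Tr x f} {Tr x f′} (trace-cong {F = ⟦ f ⟧ˢ} {⟦ f′ ⟧ˢ} (≃⇒≗ e))

  ≃-cast : ∀ {m m′ n n′} (p : m ≡ m′) (q : n ≡ n′) (f : SCirc m n) → cast p q f ≃ f
  ≃-cast refl refl f = ≃-refl

  swap-≡ : ∀ {m n} (u : Vec Value m) (v : Vec Value n) →
           drop m (u ++ v) ++ take m (u ++ v) ≡ v ++ u
  swap-≡ u v = cong₂ _++_ (drop-++ u v) (take-++ u v)

  soundness : ∀ {m n m′ n′} {f : SCirc m n} {g : SCirc m′ n′} → f ≈ g → f ≃ g
  soundness ≈-refl        = ≃-refl
  soundness (≈-sym p)     = ≃-sym (soundness p)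
  soundness (≈-trans p q) = ≃-trans (soundness p) (soundness q)
  soundness (⨾-cong p q)  = ≃-⨾ (soundness p) (soundness q)
  soundness (⊗-cong p q)  = ≃-⊗ (soundness p) (soundness q)
  soundness (Tr-cong p)   = ≃-Tr (soundness p)
  soundness (⨾-idˡ {f = f}) = ≗⇒≃ {f = id _ ⨾ f} {f} λ _ _ → refl
  soundness (⨾-idʳ {f = f}) = ≗⇒≃ {f = f ⨾ id _} {f} λ _ _ → refl
  soundness (⨾-assoc {f = f} {g} {h}) = ≗⇒≃ {f = (f ⨾ g) ⨾ h} {f ⨾ (g ⨾ h)} λ _ _ → refl
  soundness (⊗-id m n) = ≗⇒≃ {f = id m ⊗ id n} {id (m + n)} λ σ t → take++drop≡id m (σ t)
  soundness (interchange {l = l} {m} {n} {f = f} {g} {f′} {g′}) =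
    ≗⇒≃ {f = (f ⨾ g) ⊗ (f′ ⨾ g′)} {(f ⊗ f′) ⨾ (g ⊗ g′)} λ σ t → sym (cong₂ _++_
      (apply-cong ⟦ g ⟧ˢ (λ s → take-++ {m = m} _ _) t)
      (apply-cong ⟦ g′ ⟧ˢ (λ s → drop-++ {m = m} (apply ⟦ f ⟧ˢ (takeˢ l σ) s) _) t))
  soundness (⊗-unitˡ {f = f}) = ≗⇒≃ {f = id 0 ⊗ f} {f} λ _ _ → refl
  soundness (⊗-unitʳ {m = m} {n} {f = f}) = sound (+-identityʳ m) (+-identityʳ n) λ {σ} σ≋τ t → trans
    (toList-++-[] (apply ⟦ f ⟧ˢ (takeˢ m σ) t) _)
    (≋-apply ⟦ f ⟧ˢ (λ s → trans (take-+0 m (σ s)) (σ≋τ s)) t)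
  soundness (⊗-assoc {m = l} {l′} {m} {m′} {n} {n′} {f} {g} {h}) =
    sound (+-assoc l m n) (+-assoc l′ m′ n′) λ σ≋τ t → trans
      (cong toList (cong₂ _++_ (cong₂ _++_
        (apply-cong ⟦ f ⟧ˢ (λ s → take-take l m _ _ (σ≋τ s)) t)
        (apply-cong ⟦ g ⟧ˢ (λ s → drop-take l m _ _ (σ≋τ s)) t))
        (apply-cong ⟦ h ⟧ˢ (λ s → drop-+ l m _ _ (σ≋τ s)) t)))
      (toList-++-assoc (apply ⟦ f ⟧ˢ _ t) _ _)
  soundness (swap-natural {m = m} {n} {m′} {n′} {f} {g}) =
    ≗⇒≃ {f = (f ⊗ g) ⨾ swap n n′} {swap m m′ ⨾ (g ⊗ f)} λ σ t → trans
      (swap-≡ (apply ⟦ f ⟧ˢ (takeˢ m σ) t) _)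
      (sym (cong₂ _++_ (apply-cong ⟦ g ⟧ˢ (λ s → take-++ (drop m (σ s)) _) t)
                       (apply-cong ⟦ f ⟧ˢ (λ s → drop-++ (drop m (σ s)) _) t)))
  soundness (swap-involutive m n) =
    ≗⇒≃ {f = swap m n ⨾ swap n m} {id (m + n)} λ σ t → trans
      (swap-≡ (drop m (σ t)) (take m (σ t))) (take++drop≡id m (σ t))
  soundness (swap-unit m) = sound (+-identityʳ m) refl λ {σ} σ≋τ t →
    trans (cong (λ v → toList (v ++ take m (σ t))) ([]-unique (drop m (σ t)) [])) (trans (take-+0 m (σ t)) (σ≋τ t))
  soundness (swap-hexagon l m n) = sound (sym (+-assoc l m n)) (+-assoc m n l) hexagon
    where
    C : SCirc ((m + l) + n) (m + (n + l))
    C = cast (sym (+-assoc m l n)) refl (id m ⊗ swap l n)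
    hexagon : ∀ {σ : Stream (l + (m + n))} {τ : Stream ((l + m) + n)} → σ ≋ τ →
              apply ⟦ swap l (m + n) ⟧ˢ σ ≋ apply ⟦ (swap l m ⊗ id n) ⨾ C ⟧ˢ τ
    hexagon {σ} {τ} σ≋τ t = sym (trans
      (_≃_.⟦⟧-resp (≃-cast (sym (+-assoc m l n)) refl (id m ⊗ swap l n)) {τ = ρ} ρ-≋ t)
      (trans (cong toList (cong₂ _++_ (take-++ (b t) _)
        (trans (cong (λ v → drop l v ++ take l v) (drop-++ (b t) (a t ++ c t))) (swap-≡ (a t) (c t)))))
      (trans (sym (toList-++-assoc (b t) (c t) (a t)))
        (cong (λ v → toList (v ++ a t)) (take++drop≡id m (drop l (σ t)))))))
      where
      a = takeˢ l σ
      b = takeˢ m (dropˢ l σ)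
      c = dropˢ m (dropˢ l σ)
      ρ : Stream (m + (l + n))
      ρ = b ++ˢ (a ++ˢ c)
      ρ-≋ : apply ⟦ swap l m ⊗ id n ⟧ˢ τ ≋ ρ
      ρ-≋ s = trans (cong toList (cong₂ _++_ (cong₂ _++_
          (drop-take l m (τ s) (σ s) (sym (σ≋τ s)))
          (take-take l m (τ s) (σ s) (sym (σ≋τ s))))
          (drop-+ l m (τ s) (σ s) (sym (σ≋τ s)))))
        (toList-++-assoc (b s) (a s) (c s))
  soundness (tightening {x} {g = g} {f} {h}) =
    ≗⇒≃ {f = Tr x ((id x ⊗ g) ⨾ f ⨾ (id x ⊗ h))} {g ⨾ Tr x f ⨾ h}
      (trace-tightening ⟦ g ⟧ˢ ⟦ f ⟧ˢ ⟦ h ⟧ˢ ⟦ (id x ⊗ g) ⨾ f ⨾ (id x ⊗ h) ⟧ˢ λ ρ σ t →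
        apply-cong ⟦ f ⨾ (id x ⊗ h) ⟧ˢ (λ s → cong₂ _++_ (take-++ (ρ s) _)
          (apply-cong ⟦ g ⟧ˢ (λ r → drop-++ (ρ r) _) s)) t)
  soundness (sliding {x} {y} {m} {n} {f} {g}) =
    ≗⇒≃ {f = Tr x (f ⨾ (g ⊗ id n))} {Tr y ((g ⊗ id m) ⨾ f)}
      (trace-sliding ⟦ f ⟧ˢ ⟦ g ⟧ˢ ⟦ f ⨾ (g ⊗ id n) ⟧ˢ ⟦ (g ⊗ id m) ⨾ f ⟧ˢ (λ _ _ → refl)
        λ θ σ t → apply-cong ⟦ f ⟧ˢ (λ s → cong₂ _++_
          (apply-cong ⟦ g ⟧ˢ (λ r → take-++ (θ r) _) s) (drop-++ (θ s) _)) t)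
  soundness (vanishing₀ {f = f}) = ≗⇒≃ {f = Tr 0 f} {f} λ σ t →
    apply-cong ⟦ f ⟧ˢ (λ s → cong (_++ σ s) ([]-unique (lfp (feedback 0 ⟦ f ⟧ˢ σ) s) [])) t
  soundness (vanishing₊ x y {m} {n} {f}) =
    ≗⇒≃ {f = Tr (x + y) (cast (sym (+-assoc x y m)) (sym (+-assoc x y n)) f)} {Tr y (Tr x f)}
      (trace-vanishing {x} {y} ⟦ f ⟧ˢ ⟦ cast (sym (+-assoc x y m)) (sym (+-assoc x y n)) f ⟧ˢ
        (_≃_.⟦⟧-resp (≃-cast (sym (+-assoc x y m)) (sym (+-assoc x y n)) f)))
  soundness (superposing x {m} {n} {p} {q} {f} {g}) =
    ≗⇒≃ {f = Tr x (cast (+-assoc x m p) (+-assoc x n q) (f ⊗ g))} {Tr x f ⊗ g}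
      (trace-superposing {x} ⟦ f ⟧ˢ ⟦ g ⟧ˢ ⟦ cast (+-assoc x m p) (+-assoc x n q) (f ⊗ g) ⟧ˢ
        (_≃_.⟦⟧-resp (≃-sym (≃-cast (+-assoc x m p) (+-assoc x n q) (f ⊗ g)))))
  soundness (yanking x) = ≗⇒≃ {f = Tr x (swap x x)} {id x} λ σ t →
    trans (trace-at ⟦ swap x x ⟧ˢ σ σ
      (λ s → trans (take-++ (drop x (σ s ++ σ s)) _) (drop-++ (σ s) (σ s)))
      (λ ρ pre s → ⊑ᵛ-trans (⊑ᵛ-reflexive
        (sym (trans (take-++ (drop x (ρ s ++ σ s)) _) (drop-++ (ρ s) (σ s))))) (pre s)) t)
    (trans (drop-++ (drop x (σ t ++ σ t)) _) (take-++ (σ t) (σ t)))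

  -- Soundness of the reduction rules

  infixr 2 _⟨≃⟩_
  _⟨≃⟩_ : ∀ {m n m′ n′ m″ n″} {f : SCirc m n} {g : SCirc m′ n′} {h : SCirc m″ n″} →
          f ≃ g → g ≃ h → f ≃ h
  _⟨≃⟩_ = ≃-trans

  ⊔-•ʳ : ∀ a → a ⊔ • ≡ a
  ⊔-•ʳ a = antisym (∨-least ⊑-refl (•-minimum a)) (x≤x∨y a •)

  ⊔-•ˡ : ∀ a → • ⊔ a ≡ a
  ⊔-•ˡ a = antisym (∨-least (•-minimum a) ⊑-refl) (y≤x∨y • a)

  take-⊥ : ∀ m n → take m (replicate (m + n) •) ≡ replicate m •
  take-⊥ zero    n = refl
  take-⊥ (suc m) n = cong (• ∷_) (take-⊥ m n)

  drop-⊥ : ∀ m n → drop m (replicate (m + n) •) ≡ replicate n •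
  drop-⊥ zero    n = refl
  drop-⊥ (suc m) n = drop-⊥ m n

  ⊥-++ : ∀ m n → replicate m • ++ replicate n • ≡ replicate (m + n) •
  ⊥-++ zero    n = refl
  ⊥-++ (suc m) n = cong (• ∷_) (⊥-++ m n)

  -- Neither delays nor traces occur in `h`, so nothing is remembered between ticks. Allowing two
  -- different ticks lets `eval`, taken at tick 0 of a constant stream, describe every tick.
  pointwise : ∀ {m n} (h : CCirc m n) {σ τ : Stream m} {s t} → σ s ≡ τ t →
              apply ⟦ ⌈ h ⌉ ⟧ˢ σ s ≡ apply ⟦ ⌈ h ⌉ ⟧ˢ τ t
  pointwise (prim p)   eq = cong ⟦ p ⟧ᵖ eq
  pointwise fork       eq = cong (λ v → apply ⟦ fork ⟧ˢ (λ _ → v) 0) eq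
  pointwise join       eq = cong (λ v → apply ⟦ join ⟧ˢ (λ _ → v) 0) eq
  pointwise intro      eq = refl
  pointwise elim       eq = refl
  pointwise (id n)     eq = eq
  pointwise (swap m n) eq = cong (λ v → drop m v ++ take m v) eq
  pointwise (f ⨾ g)    eq = pointwise g (pointwise f eq)
  pointwise (_⊗_ {m = m} f g) {σ} {τ} {s} {t} eq = cong₂ _++_
    (pointwise f {takeˢ m σ} {takeˢ m τ} {s} {t} (cong (take m) eq))
    (pointwise g {dropˢ m σ} {dropˢ m τ} {s} {t} (cong (drop m) eq))

  eval : ∀ {m n} → CCirc m n → Vec Value m → Vec Value n
  eval h v = apply ⟦ ⌈ h ⌉ ⟧ˢ (λ _ → v) 0

  eval-mono : ∀ {m n} (h : CCirc m n) {u v} → u ⊑ᵛ v → eval h u ⊑ᵛ eval h v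
  eval-mono h u⊑v = mono ⟦ ⌈ h ⌉ ⟧ˢ (λ _ → u⊑v) 0

  -- Here strictness of the primitives enters. A block of values emits ⊥ after tick 0, and a
  -- combinational circuit must preserve this for its output to be a block of values again.
  eval-⊥ : ∀ {m n} (h : CCirc m n) → eval h (replicate m •) ≡ replicate n •
  eval-⊥ (prim p)   = ⟦⟧ᵖ-strict p
  eval-⊥ fork       = refl
  eval-⊥ join       = cong (_∷ []) (⊔-•ʳ •)
  eval-⊥ intro      = refl
  eval-⊥ elim       = refl
  eval-⊥ (id n)     = refl
  eval-⊥ (swap m n) = trans (cong₂ _++_ (drop-⊥ m n) (take-⊥ m n)) (⊥-++ n m)
  eval-⊥ (f ⨾ g)    = trans (pointwise g {s = 0} {0} (eval-⊥ f)) (eval-⊥ g)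
  eval-⊥ (_⊗_ {m = m} {n} {m′} {n′} f g) = trans (cong₂ _++_
    (trans (cong (eval f) (take-⊥ m m′)) (eval-⊥ f))
    (trans (cong (eval g) (drop-⊥ m m′)) (eval-⊥ g))) (⊥-++ n n′)

  value-at : ∀ v σ t → apply ⟦ value v ⟧ˢ σ t ≡ ((v ∷ []) ∷ˢ ⊥ˢ) t
  value-at v σ t with v ≟ •
  value-at v σ zero    | yes v≡• = cong (_∷ []) (sym v≡•)
  value-at v σ (suc t) | yes _   = refl
  value-at v σ t       | no _    = refl

  values-at : ∀ {n} (v : Vec Value n) σ t → apply ⟦ values v ⟧ˢ σ t ≡ (v ∷ˢ ⊥ˢ) t
  values-at [] σ t = []-unique _ _
  values-at (a ∷ v) σ t = trans (cong₂ _++_ (value-at a _ t) (values-at v _ t)) (∷ˢ-++ t)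
    where
    ∷ˢ-++ : ∀ t → ((a ∷ []) ∷ˢ ⊥ˢ) t ++ (v ∷ˢ ⊥ˢ) t ≡ ((a ∷ v) ∷ˢ ⊥ˢ) t
    ∷ˢ-++ zero    = refl
    ∷ˢ-++ (suc t) = refl

  -- At tick 0 the delay contributes ⊥ to the join, and at every later tick the value does.
  reg₁-at : ∀ a σ t → apply ⟦ reg₁ a ⟧ˢ σ t ≡ ((a ∷ []) ∷ˢ σ) t
  reg₁-at a σ t = trans
    (apply-cong ⟦ join ⟧ˢ {τ = λ s → ((a ∷ []) ∷ˢ ⊥ˢ) s ++ apply delayˢ σ s}
      (λ s → cong (_++ apply delayˢ σ s) (value-at a _ s)) t)
    (joined t)
    where
    ⊥-join : (v : Vec Value 1) → apply ⟦ join ⟧ˢ (λ _ → • ∷ v) 0 ≡ v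
    ⊥-join (b ∷ []) = cong (_∷ []) (⊔-•ˡ b)
    joined : ∀ t → apply ⟦ join ⟧ˢ (λ s → ((a ∷ []) ∷ˢ ⊥ˢ) s ++ apply delayˢ σ s) t ≡ ((a ∷ []) ∷ˢ σ) t
    joined zero    = cong (_∷ []) (⊔-•ʳ a)
    joined (suc t) = ⊥-join (σ t)

  reg-at : ∀ {n} (v : Vec Value n) σ t → apply ⟦ reg v ⟧ˢ σ t ≡ (v ∷ˢ σ) t
  reg-at [] σ t = []-unique _ _
  reg-at (a ∷ v) σ t = trans (≃⇒≗ (soundness (reg-∷ a v)) σ t)
    (trans (cong₂ _++_ (reg₁-at a _ t) (reg-at v _ t)) (∷ˢ-++ t))
    where
    ∷ˢ-++ : ∀ t → ((a ∷ []) ∷ˢ takeˢ 1 σ) t ++ (v ∷ˢ dropˢ 1 σ) t ≡ ((a ∷ v) ∷ˢ σ) t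
    ∷ˢ-++ zero    = refl
    ∷ˢ-++ (suc t) = take++drop≡id 1 (σ t)

  delays-at : ∀ n σ t → apply ⟦ delays n ⟧ˢ σ t ≡ (replicate n • ∷ˢ σ) t
  delays-at zero σ t = []-unique _ _
  delays-at (suc n) σ t = trans (cong (apply delayˢ (takeˢ 1 σ) t ++_) (delays-at n _ t)) (∷ˢ-++ t)
    where
    ∷ˢ-++ : ∀ t → apply delayˢ (takeˢ 1 σ) t ++ (replicate n • ∷ˢ dropˢ 1 σ) t ≡ (replicate (suc n) • ∷ˢ σ) t
    ∷ˢ-++ zero    = refl
    ∷ˢ-++ (suc t) = take++drop≡id 1 (σ t)

  reg-⊥ : ∀ n → reg (replicate n •) ≃ delays n
  reg-⊥ n = ≗⇒≃ {f = reg (replicate n •)} {delays n} λ σ t →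
    trans (reg-at (replicate n •) σ t) (sym (delays-at n σ t))

  intros-at : ∀ n σ t → apply ⟦ intros n ⟧ˢ σ t ≡ replicate n •
  intros-at zero    σ t = []-unique _ _
  intros-at (suc n) σ t = cong (• ∷_) (intros-at n σ t)

  -- A register that is only ever fed ⊥ emits its content once, like a value. This is what allows
  -- (Mealy) to treat values as state.
  intros-reg : ∀ {n} (v : Vec Value n) → intros n ⨾ reg v ≃ values v
  intros-reg {n} v = ≗⇒≃ {f = intros n ⨾ reg v} {values v} λ σ t →
    trans (apply-cong ⟦ reg v ⟧ˢ (intros-at n σ) t)
    (trans (reg-at v ⊥ˢ t) (sym (values-at v σ t)))

  Sound : CircuitRel → Set
  Sound R = ∀ {m n} {f g : SCirc m n} → R f g → f ≃ g

  Step-sound : ∀ {R : CircuitRel} → Sound R → Sound (Step R)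
  Step-sound R-sound (rule r)       = R-sound r
  Step-sound R-sound (⨾-left s)     = ≃-⨾ (Step-sound R-sound s) ≃-refl
  Step-sound R-sound (⨾-right s)    = ≃-⨾ ≃-refl (Step-sound R-sound s)
  Step-sound R-sound (⊗-left s)     = ≃-⊗ (Step-sound R-sound s) ≃-refl
  Step-sound R-sound (⊗-right s)    = ≃-⊗ ≃-refl (Step-sound R-sound s)
  Step-sound R-sound (Tr-body s)    = ≃-Tr (Step-sound R-sound s)
  Step-sound R-sound (modulo p s q) = ≃-trans (soundness p) (≃-trans (Step-sound R-sound s) (soundness q))

  Star-sound : ∀ {R : CircuitRel} → Sound R → ∀ {m n} {f g : SCirc m n} → Star (Step R {m} {n}) f g → f ≃ g
  Star-sound R-sound ε       = ≃-refl
  Star-sound R-sound (s ◅ ss) = ≃-trans (Step-sound R-sound s) (Star-sound R-sound ss)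

  values-sound : ∀ {m n} (h : CCirc m n) (v : Vec Value m) → values v ⨾ ⌈ h ⌉ ≃ values (eval h v)
  values-sound {m} h v = ≗⇒≃ {f = values v ⨾ ⌈ h ⌉} {values (eval h v)} λ σ t →
    trans (pointwise h {τ = v ∷ˢ ⊥ˢ} (values-at v σ t)) (trans (at t) (sym (values-at (eval h v) σ t)))
    where
    at : ∀ t → apply ⟦ ⌈ h ⌉ ⟧ˢ (v ∷ˢ ⊥ˢ) t ≡ (eval h v ∷ˢ ⊥ˢ) t
    at zero    = pointwise h {v ∷ˢ ⊥ˢ} {λ _ → v} {0} {0} refl
    at (suc t) = trans (pointwise h {v ∷ˢ ⊥ˢ} {⊥ˢ} {suc t} {0} refl) (eval-⊥ h)

  Value-sound : Sound ValueRule
  Value-sound (v-fork v) =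
    soundness (⨾-cong (≈-sym ⊗-unitʳ) ≈-refl) ⟨≃⟩ values-sound fork (v ∷ []) ⟨≃⟩
    soundness (⊗-cong ≈-refl ⊗-unitʳ)
  Value-sound (v-join v w) =
    soundness (⨾-cong (⊗-cong ≈-refl (≈-sym ⊗-unitʳ)) ≈-refl) ⟨≃⟩
    values-sound join (v ∷ w ∷ []) ⟨≃⟩ soundness ⊗-unitʳ
  Value-sound (v-elim v) =
    soundness (⨾-cong (≈-sym ⊗-unitʳ) ≈-refl) ⟨≃⟩ values-sound elim (v ∷ [])
  Value-sound (v-prim p v) = values-sound (prim p) v

  -- Because `h` acts tick by tick, both sides denote `h` followed by registers that hold
  -- `eval h v`.
  Str-sound : Sound Str
  Str-sound (str {a} {b} h v) =
    ≗⇒≃ {f = reg v ⨾ ⌈ h ⌉} {⌈ h ⌉ ⨾ reg w} (λ σ t →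
      trans (pointwise h {τ = v ∷ˢ σ} (reg-at v σ t))
      (trans (at σ t) (sym (reg-at w (apply ⟦ ⌈ h ⌉ ⟧ˢ σ) t)))) ⟨≃⟩
    soundness (≈-sym (⨾-reg ⌈ h ⌉ w)) ⟨≃⟩
    ≃-⨾ (≃-⊗ (≃-sym (values-sound h v)) ≃-refl) ≃-refl
    where
    w = eval h v
    at : ∀ σ t → apply ⟦ ⌈ h ⌉ ⟧ˢ (v ∷ˢ σ) t ≡ (w ∷ˢ apply ⟦ ⌈ h ⌉ ⟧ˢ σ) t
    at σ zero    = pointwise h {v ∷ˢ σ} {λ _ → v} {0} {0} refl
    at σ (suc t) = pointwise h {v ∷ˢ σ} {σ} {suc t} {t} refl

  -- The rule is read backwards: sliding carries the `intros z` from behind the core round the loop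
  -- to the inputs of the registers, where `intros-reg` and `reg-⊥` turn the registers back into
  -- values and delays.
  Mealy-sound : Sound Mealy
  Mealy-sound (mealy x y z {m} {n} f̂ v) = ≃-sym (
    soundness (Tr-cong body) ⟨≃⟩
    soundness (sliding {x + (y + z)} {x + y} {m} {n} {F} {g}) ⟨≃⟩
    ≃-Tr (
      soundness (begin
        (g ⊗ id m) ⨾ F
          ≈⟨ ⨾-cong (≈-trans ⊗-assoc (⊗-cong ≈-refl (⊗-cong (cast-≈ _ _ _) ≈-refl))) (cast-≈ _ _ _) ⟩
        (id x ⊗ ((id y ⊗ intros z) ⊗ id m)) ⨾ (id x ⊗ (reg state ⊗ id m)) ⨾ ⌈ f̂′ ⌉
          ≈⟨ ≈-trans (≈-sym ⨾-assoc) (⨾-cong (≈-trans (≈-sym (id-⊗-⨾ x)) (⊗-cong ≈-refl (≈-sym (⨾-⊗-id m)))) ≈-refl) ⟩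
        (id x ⊗ (((id y ⊗ intros z) ⨾ reg state) ⊗ id m)) ⨾ ⌈ f̂′ ⌉
          ≈⟨ ⨾-cong (⊗-cong ≈-refl (⊗-cong (begin
               (id y ⊗ intros z) ⨾ reg state                       ≈⟨ ⨾-cong ≈-refl (reg-++ (replicate y •) v) ⟩
               (id y ⊗ intros z) ⨾ (reg (replicate y •) ⊗ reg v)   ≈⟨ ⊗-⨾-⊗ ⟩
               (id y ⨾ reg (replicate y •)) ⊗ (intros z ⨾ reg v)   ≈⟨ ⊗-cong ⨾-idˡ ≈-refl ⟩
               reg (replicate y •) ⊗ (intros z ⨾ reg v)            ∎) ≈-refl)) ≈-refl ⟩
        (id x ⊗ ((reg (replicate y •) ⊗ (intros z ⨾ reg v)) ⊗ id m)) ⨾ ⌈ f̂′ ⌉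
          ∎) ⟨≃⟩
      ≃-⨾ (≃-⊗ (≃-refl {f = id x}) (≃-⊗ (≃-⊗ (reg-⊥ y) (intros-reg v)) (≃-refl {f = id m}))) (≃-refl {f = ⌈ f̂′ ⌉}) ⟨≃⟩
      soundness (begin
        (id x ⊗ ((delays y ⊗ values v) ⊗ id m)) ⨾ ⌈ f̂′ ⌉
          ≈⟨ ⨾-cong (⊗-cong ≈-refl ⊗-assoc) (⌈cast⌉ _ _ f̂) ⟩
        (id x ⊗ (delays y ⊗ (values v ⊗ id m))) ⨾ ⌈ f̂ ⌉
          ≈⟨ cast-≈ _ _ _ ⟨
        cast (sym (+-assoc x y m)) (sym (+-assoc x y n))
          ((id x ⊗ (delays y ⊗ (values v ⊗ id m))) ⨾ ⌈ f̂ ⌉) ∎)))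
    where
    state = replicate y • ++ v
    f̂′ : CCirc (x + ((y + z) + m)) (x + (y + n))
    f̂′ = cast (cong (x +_) (sym (+-assoc y z m))) refl f̂
    g : SCirc (x + y) (x + (y + z))
    g = id x ⊗ cast (+-identityʳ y) refl (id y ⊗ intros z)
    F : SCirc ((x + (y + z)) + m) ((x + y) + n)
    F = cast (sym (+-assoc x (y + z) m)) (sym (+-assoc x y n)) ((id x ⊗ (reg state ⊗ id m)) ⨾ ⌈ f̂′ ⌉)
    body : cast (sym (+-assoc x (y + z) m))
                (trans (cong (x +_) (sym (+-assoc y z n))) (sym (+-assoc x (y + z) n)))
             ((id x ⊗ (reg state ⊗ id m)) ⨾
              cast (cong (x +_) (sym (+-assoc y z m))) refl ⌈ f̂ ⌉ ⨾
              (id x ⊗ (id y ⊗ (intros z ⊗ id n))))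
           ≈ F ⨾ (g ⊗ id n)
    body = ≈-trans (cast-≈ _ (trans (cong (x +_) (sym (+-assoc y z n))) (sym (+-assoc x (y + z) n))) _) (begin
      (id x ⊗ (reg state ⊗ id m)) ⨾
        cast (cong (x +_) (sym (+-assoc y z m))) refl ⌈ f̂ ⌉ ⨾
        (id x ⊗ (id y ⊗ (intros z ⊗ id n)))
        ≈⟨ ≈-trans (⨾-cong ≈-refl (⨾-cong (≈-trans (cast-≈ _ _ _) (≈-sym (⌈cast⌉ _ _ f̂))) ≈-refl)) (≈-sym ⨾-assoc) ⟩
      ((id x ⊗ (reg state ⊗ id m)) ⨾ ⌈ f̂′ ⌉) ⨾ (id x ⊗ (id y ⊗ (intros z ⊗ id n)))
        ≈⟨ ⨾-cong (cast-≈ _ _ _)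
            (≈-trans ⊗-assoc (⊗-cong ≈-refl (≈-trans (⊗-cong (cast-≈ _ _ _) ≈-refl) ⊗-assoc))) ⟨
      F ⨾ (g ⊗ id n) ∎)

  forks-at : ∀ n σ t → apply ⟦ ⌈ forks n ⌉ ⟧ˢ σ t ≡ σ t ++ σ t
  forks-at zero    σ t = []-unique _ _
  forks-at (suc n) σ t = toList-inj (trans
    (_≃_.⟦⟧-resp (soundness unfolded) {σ} {σ} (λ _ → refl) t)
    (goal (σ t) _ (forks-at n (dropˢ 1 σ) t)))
    where
    f₁ : SCirc (suc (suc n + n)) (suc ((n + 1) + n))
    f₁ = id 1 ⊗ (swap 1 n ⊗ id n)
    unfolded : ⌈ forks (suc n) ⌉ ≈ (fork ⊗ ⌈ forks n ⌉) ⨾ f₁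
    unfolded = ⨾-cong ≈-refl (⊗-cong ≈-refl (⌈cast⌉ refl (+-assoc n 1 n) (swap 1 n ⊗ id n)))
    goal : (u : Vec Value (suc n)) (v : Vec Value (n + n)) → v ≡ drop 1 u ++ drop 1 u →
           toList (apply ⟦ f₁ ⟧ˢ (λ _ → apply ⟦ fork ⟧ˢ (λ _ → take 1 u) 0 ++ v) 0) ≡ toList (u ++ u)
    goal (a ∷ u) _ refl = cong (a List.∷_) (trans
      (cong toList (cong₂ _++_ (cong (_++ (a ∷ [])) (take-++ u u)) (drop-++ u u)))
      (toList-++-assoc u (a ∷ []) u))

  module KleeneIteration {x a b : ℕ} (h : CCirc (x + a) (x + b)) (u : Vec Value a) where

    body : Vec Value x → Vec Value (x + b)
    body v = eval h (v ++ u)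

    approx : ℕ → Vec Value x
    approx zero    = replicate x •
    approx (suc k) = take x (body (approx k))

    approx-step : ∀ k → approx k ⊑ᵛ approx (suc k)
    approx-step zero    = ⊥ᵛ-minimum _
    approx-step (suc k) = take-mono x (eval-mono h (Pointwise.++⁺ (approx-step k) ⊑ᵛ-refl))

    approx-stable : ∀ {k d} → k ≤ d → approx k ≡ approx (suc k) → approx d ≡ approx (suc d)
    approx-stable {k} {d} k≤d eq =
      subst (λ i → approx i ≡ approx (suc i)) (ℕ.m∸n+n≡m k≤d) (go (d ∸ k))
      where
      go : ∀ j → approx (j + k) ≡ approx (suc (j + k))
      go zero    = eq
      go (suc j) = cong (λ v → take x (body v)) (go j)

    -- Once two successive approximants agree, all later ones do. If number `d` still moved, every
    -- earlier one would have moved too, giving a chain with `suc d` strict steps.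
    approx-fixed : ∀ {d} → LongestChain x d → approx d ≡ approx (suc d)
    approx-fixed {d} (_ , longest) with ≡-dec _≟_ (approx d) (approx (suc d))
    ... | yes eq = eq
    ... | no neq = ⊥-elim (ℕ.<-irrefl refl (longest {suc d} (chain , strict)))
      where
      chain : Fin (suc (suc d)) → Vec Value x
      chain i = approx (toℕ i)
      strict : ∀ (i : Fin (suc d)) → chain (inject₁ i) ⊏ᵛ chain (fsuc i)
      strict i rewrite Fin.toℕ-inject₁ i =
        approx-step (toℕ i) , λ eq → neq (approx-stable (ℕ.≤-pred (Fin.toℕ<n i)) eq)

  module _ {x a b : ℕ} (h : CCirc (x + a) (x + b)) where
    open KleeneIteration {x} {a} {b} h

    -- The indices are shifted: the feedback outputs of `iterate h k` form approximant `suc k`,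
    -- since even `iterate h 0` applies `h` once.
    iterate-at : ∀ k σ t → apply ⟦ ⌈ iterate {x} {a} {b} h k ⌉ ⟧ˢ σ t ≡ body (σ t) (approx (σ t) k)
    iterate-at zero    σ t = pointwise h {t = 0}
      (cong (_++ σ t) (trans (cong (λ f → apply ⟦ f ⟧ˢ _ t) (⌈intros⌉ x)) (intros-at x _ t)))
    iterate-at (suc k) σ t = pointwise h {t = 0} (cong₂ _++_
      (toList-inj (trans
        (_≃_.⟦⟧-resp (soundness (⌈cast⌉ refl (+-identityʳ x) (id x ⊗ elims b))) {ρ} {ρ} (λ _ → refl) t)
        (trans (toList-++-[] (take x (ρ t)) _)
          (cong (λ v → toList (take x v)) (trans (iterate-at k _ t)
            (cong (λ v → body v (approx v k)) (trans (cong (take a) (forks-at a σ t)) (take-++ (σ t) (σ t)))))))))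
      (trans (cong (drop a) (forks-at a σ t)) (drop-++ (σ t) (σ t))))
      where
      ρ : Stream (x + b)
      ρ = apply ⟦ ⌈ iterate {x} {a} {b} h k ⌉ ⟧ˢ (takeˢ a (apply ⟦ ⌈ forks a ⌉ ⟧ˢ σ))

  -- A loop without delays can be solved at each tick separately, so the stream of tickwise Kleene
  -- limits is the least fixed point.
  IF-sound : Sound IF
  IF-sound (if x {a} {b} {d} h longest) =
    ≗⇒≃ {f = Tr x ⌈ h ⌉} {⌈ iterate {x} {a} {b} h (suc d) ⌉ ⨾ (elims x ⊗ id b)} λ σ t → trans
      (trace-at ⟦ ⌈ h ⌉ ⟧ˢ σ (τ σ) (fixed σ) (least σ) t)
      (sym (trans (elims-⊗ (apply ⟦ ⌈ iterate {x} {a} {b} h (suc d) ⌉ ⟧ˢ σ) t)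
        (cong (drop x) (trans (iterate-at {x} {a} {b} h (suc d) σ t)
          (pointwise h {s = 0} {t} (cong (_++ σ t) (sym (approx-fixed (σ t) longest))))))))
    where
    open KleeneIteration {x} {a} {b} h
    τ : Stream a → Stream x
    τ σ t = approx (σ t) d
    at : ∀ σ ρ t → apply ⟦ ⌈ h ⌉ ⟧ˢ (ρ ++ˢ σ) t ≡ body (σ t) (ρ t)
    at σ ρ t = pointwise h {s = t} {0} refl
    fixed : ∀ σ t → take x (apply ⟦ ⌈ h ⌉ ⟧ˢ (τ σ ++ˢ σ) t) ≡ τ σ t
    fixed σ t = trans (cong (take x) (at σ (τ σ) t)) (sym (approx-fixed (σ t) longest))
    least : ∀ σ ρ → (∀ t → take x (apply ⟦ ⌈ h ⌉ ⟧ˢ (ρ ++ˢ σ) t) ⊑ᵛ ρ t) → τ σ ⊑ˢ ρ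
    least σ ρ pre t = below d
      where
      below : ∀ k → approx (σ t) k ⊑ᵛ ρ t
      below zero    = ⊥ᵛ-minimum _
      below (suc k) = ⊑ᵛ-trans (take-mono x (eval-mono h (Pointwise.++⁺ (below k) ⊑ᵛ-refl)))
        (⊑ᵛ-trans (⊑ᵛ-reflexive (cong (take x) (sym (at σ ρ t)))) (pre t))
    elims-⊗ : ∀ ρ t → apply ⟦ elims x ⊗ id b ⟧ˢ ρ t ≡ drop x (ρ t)
    elims-⊗ ρ t = cong (_++ drop x (ρ t)) ([]-unique (apply ⟦ elims x ⟧ˢ (takeˢ x ρ) t) [])

  -- Chains

  ∃-value? : ∀ {P : Value → Set} → Decidable P → Dec (∃[ a ] P a)
  ∃-value? {P} P? = map′
    (λ (i , p) → _ , p)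
    (λ (a , p) → Inverse.to finite a , subst P (sym (Inverse.strictlyInverseʳ finite a)) p)
    (Fin.any? (P? ∘ Inverse.from finite))

  ∃-vec? : ∀ {x} {P : Vec Value x → Set} → Decidable P → Dec (∃[ v ] P v)
  ∃-vec? {zero}  P? = map′ ([] ,_) (λ { ([] , p) → p }) (P? [])
  ∃-vec? {suc x} P? = map′ (λ (a , v , p) → a ∷ v , p) (λ { (a ∷ v , p) → a , v , p })
    (∃-value? (λ a → ∃-vec? (λ v → P? (a ∷ v))))

  -- The order is an abstract relation, but `a ⊑ b` amounts to `a ⊔ b ≡ b`, and equality of values
  -- is decidable.
  _⊑?_ : ∀ a b → Dec (a ⊑ b)
  a ⊑? b = map′ (λ eq → subst (a ⊑_) eq (x≤x∨y a b))
    (λ a⊑b → antisym (∨-least a⊑b ⊑-refl) (y≤x∨y a b)) (a ⊔ b ≟ b)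

  _⊏ᵛ?_ : ∀ {x} (u v : Vec Value x) → Dec (u ⊏ᵛ v)
  u ⊏ᵛ? v = Pointwise.decidable _⊑?_ u v ×-dec ¬? (≡-dec _≟_ u v)

  -- Chains as functions on `Fin` cannot be searched directly; building them one vector at a time
  -- reduces the search to finitely many choices per step.
  ChainFrom : ∀ {x} → Vec Value x → ℕ → Set
  ChainFrom u zero    = ⊤
  ChainFrom u (suc d) = ∃[ v ] u ⊏ᵛ v × ChainFrom v d

  chainFrom? : ∀ {x} (u : Vec Value x) d → Dec (ChainFrom u d)
  chainFrom? u zero    = yes tt
  chainFrom? u (suc d) = ∃-vec? (λ v → (u ⊏ᵛ? v) ×-dec chainFrom? v d)

  Chain⇒ChainFrom : ∀ {x} d ((c , _) : Chain x d) → ChainFrom (c zero) d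
  Chain⇒ChainFrom zero    _            = tt
  Chain⇒ChainFrom (suc d) (c , strict) =
    c (fsuc zero) , strict zero , Chain⇒ChainFrom d (c ∘ fsuc , strict ∘ fsuc)

  ChainFrom⇒Chain : ∀ {x} d {u : Vec Value x} → ChainFrom u d → Σ[ (c , _) ∈ Chain x d ] c zero ≡ u
  ChainFrom⇒Chain zero    {u} _ = ((λ _ → u) , λ ()) , refl
  ChainFrom⇒Chain (suc d) {u} (v , u⊏v , rest) with ChainFrom⇒Chain d rest
  ... | (c , strict) , refl =
    ((λ { zero → u ; (fsuc i) → c i }) , λ { zero → u⊏v ; (fsuc i) → strict i }) , refl

  chain? : ∀ x d → Dec (Chain x d)
  chain? x d = map′ (λ (_ , r) → proj₁ (ChainFrom⇒Chain d r)) (λ c → _ , Chain⇒ChainFrom d c)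
    (∃-vec? {x} (λ u → chainFrom? u d))

  ⊏ᵛ-trans : ∀ {x} {u v w : Vec Value x} → u ⊏ᵛ v → v ⊏ᵛ w → u ⊏ᵛ w
  ⊏ᵛ-trans (u⊑v , u≢v) (v⊑w , _) = ⊑ᵛ-trans u⊑v v⊑w ,
    λ { refl → u≢v (⊑ᵛ-antisym u⊑v v⊑w) }

  chain-< : ∀ {x} d ((c , _) : Chain x d) i j → toℕ i < toℕ j → c i ⊏ᵛ c j
  chain-< (suc d) (c , strict) zero (fsuc zero) _ = strict zero
  chain-< (suc (suc d)) (c , strict) zero (fsuc (fsuc j)) _ =
    ⊏ᵛ-trans (strict zero) (chain-< (suc d) (c ∘ fsuc , strict ∘ fsuc) zero (fsuc j) (s≤s z≤n))
  chain-< (suc d) (c , strict) (fsuc i) (fsuc j) (s≤s i<j) =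
    chain-< d (c ∘ fsuc , strict ∘ fsuc) i j i<j

  chain-bounded : ∀ {x d} → Chain x d → d ≤ ∣V∣ ^ x
  chain-bounded {x} {d} (c , strict) = ℕ.≮⇒≥ λ N<d →
    let i , j , i<j , eq = Fin.pigeonhole (ℕ.m<n⇒m<1+n N<d) (λ i → encode (c i))
    in proj₂ (chain-< d (c , strict) i j i<j) (encode-injective eq)

  -- (IF) demands a proof that `d` is longest, so one must be found constructively. The search
  -- descends from the pigeonhole bound and stops at 0 at the latest, where one vector is a chain.
  longestChain : ∀ x → ∃[ d ] LongestChain x d
  longestChain x = search (∣V∣ ^ x) chain-bounded
    where
    search : ∀ k → (∀ {d} → Chain x d → d ≤ k) → ∃[ d ] LongestChain x d
    search k bounded with chain? x k
    search k       bounded | yes chain = k , chain , bounded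
    search zero    bounded | no ¬chain = ⊥-elim (¬chain ((λ _ → replicate x •) , λ ()))
    search (suc k) bounded | no ¬chain = search k λ {d} chain →
      ℕ.≤-pred (ℕ.≤∧≢⇒< (bounded chain) λ { refl → ¬chain chain })

  -- Productivity

  -- Value rules fire at forks, joins, eliminations and primitives; introductions, identities and
  -- symmetries are settled by the axioms, composites by induction.
  values-⨾ : ∀ {m n} (h : CCirc m n) (v : Vec Value m) →
             Σ[ w ∈ Vec Value n ] ValueRule ⊢ values v ⨾ ⌈ h ⌉ ⇝ values w
  values-⨾ (prim p) v = _ , rule (v-prim p v) ◃ done ≈-refl
  values-⨾ fork (a ∷ []) = a ∷ a ∷ [] ,
    modulo (⨾-cong ⊗-unitʳ ≈-refl) (rule (v-fork a)) (⊗-cong ≈-refl (≈-sym ⊗-unitʳ)) ◃ done ≈-refl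
  values-⨾ join (a ∷ b ∷ []) = a ⊔ b ∷ [] ,
    modulo (⨾-cong (⊗-cong ≈-refl ⊗-unitʳ) ≈-refl) (rule (v-join a b)) (≈-sym ⊗-unitʳ) ◃ done ≈-refl
  values-⨾ intro [] = • ∷ [] ,
    done (≈-trans ⨾-idˡ (≈-trans (≈-sym value-•) (≈-sym ⊗-unitʳ)))
  values-⨾ elim (a ∷ []) = [] ,
    modulo (⨾-cong ⊗-unitʳ ≈-refl) (rule (v-elim a)) ≈-refl ◃ done ≈-refl
  values-⨾ (id n) v = v , done ⨾-idʳ
  values-⨾ (swap m n) v with splitAt m v
  ... | u , u′ , refl = u′ ++ u , done (begin
    values (u ++ u′) ⨾ swap m n         ≈⟨ ⨾-cong (values-++ u u′) ≈-refl ⟩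
    (values u ⊗ values u′) ⨾ swap m n   ≈⟨ swap-natural ⟩
    swap 0 0 ⨾ (values u′ ⊗ values u)   ≈⟨ ⨾-cong (swap-unit 0) ≈-refl ⟩
    id 0 ⨾ (values u′ ⊗ values u)       ≈⟨ ⨾-idˡ ⟩
    values u′ ⊗ values u                ≈⟨ values-++ u′ u ⟨
    values (u′ ++ u)                    ∎)
  values-⨾ (f ⨾ g) v with values-⨾ f v
  ... | u , r with values-⨾ g u
  ... | w , r′ = w , ⇝-≈ˡ (≈-sym ⨾-assoc) (⇝-trans (⇝-⨾ˡ r) r′)
  values-⨾ (_⊗_ {m = m} f g) v with splitAt m v
  ... | u , u′ , refl with values-⨾ f u | values-⨾ g u′
  ... | w , r | w′ , r′ = w ++ w′ ,
    ⇝-≈ˡ (≈-trans (⨾-cong (values-++ u u′) ≈-refl) ⊗-⨾-⊗)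
         (⇝-≈ʳ (⇝-⊗ r r′) (≈-sym (values-++ w w′)))

  -- After (Mealy) all state sits in one block of registers, and tightening places `reg v` beside
  -- it. State and input then meet one combinational circuit, once (IF) has opened the delay-free
  -- loop.
  productive : ∀ {m n} (f : SCirc m n) (v : Vec Value m) →
               ∃[ f′ ] ∃[ w ] Productive f v f′ w
  productive {m} {n} f v with traceDelayForm f
  ... | globalTraceDelay x y {z} i core p with longestChain x
  ... | d , longest-d = result
    where
    s : ℕ
    s = y + z
    state : Vec Value s
    state = replicate y • ++ i

    h : CCirc (x + (s + m)) (x + (s + n))
    h = cast (cong (x +_) (sym (+-assoc y z m))) (cong (x +_) (sym (+-assoc y z n)))
      (core ⨾ (id x ⊗ (id y ⊗ (intros z ⊗ id n))))

    clocked : SCirc m n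
    clocked = Tr (x + s)
      (cast (sym (+-assoc x s m)) (trans (cong (x +_) (sym (+-assoc y z n))) (sym (+-assoc x s n)))
        ((id x ⊗ (reg state ⊗ id m)) ⨾
         cast (cong (x +_) (sym (+-assoc y z m))) refl ⌈ core ⌉ ⨾
         (id x ⊗ (id y ⊗ (intros z ⊗ id n)))))

    mealy-step : Step Mealy (reg v ⨾ f) (reg v ⨾ clocked)
    mealy-step = ⨾-right (modulo p (rule (mealy x y z core i)) ≈-refl)

    k : CCirc (s + m) (s + n)
    k = iterate {x} {s + m} {s + n} h (suc d) ⨾ (elims x ⊗ id (s + n))

    body : (id x ⊗ (reg state ⊗ id m)) ⨾
           cast (cong (x +_) (sym (+-assoc y z m))) refl ⌈ core ⌉ ⨾
           (id x ⊗ (id y ⊗ (intros z ⊗ id n)))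
         ≈ (id x ⊗ (reg state ⊗ id m)) ⨾ ⌈ h ⌉
    body = ⨾-cong ≈-refl (begin
      cast (cong (x +_) (sym (+-assoc y z m))) refl ⌈ core ⌉ ⨾
      (id x ⊗ (id y ⊗ (intros z ⊗ id n)))
        ≈⟨ ⨾-cong (cast-≈ _ _ _)
             (⊗-cong ≈-refl (⊗-cong ≈-refl (⊗-cong (≡⇒≈ (sym (⌈intros⌉ z))) ≈-refl))) ⟩
      ⌈ core ⨾ (id x ⊗ (id y ⊗ (intros z ⊗ id n))) ⌉ ≈⟨ ⌈cast⌉ _ _ _ ⟨
      ⌈ h ⌉ ∎)

    -- Vanishing separates the `x` instantaneous wires, to which (IF) applies, from the `s` wires
    -- that run through registers.
    clocked-≈ : clocked ≈ Tr s ((reg state ⊗ id m) ⨾ Tr x ⌈ h ⌉)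
    clocked-≈ = begin
      clocked
        ≈⟨ Tr-cong (≈-trans (cast-≈ _ _ _) (≈-trans body (≈-sym (cast-≈ _ _ _)))) ⟩
      Tr (x + s) (cast (sym (+-assoc x s m)) (sym (+-assoc x s n))
        ((id x ⊗ (reg state ⊗ id m)) ⨾ ⌈ h ⌉))              ≈⟨ vanishing₊ x s ⟩
      Tr s (Tr x ((id x ⊗ (reg state ⊗ id m)) ⨾ ⌈ h ⌉))     ≈⟨ Tr-cong tighten ⟨
      Tr s ((reg state ⊗ id m) ⨾ Tr x ⌈ h ⌉)                ∎

    absorb : reg v ⨾ clocked ≈ Tr s (reg (state ++ v) ⨾ Tr x ⌈ h ⌉)
    absorb = begin
      reg v ⨾ clocked                                            ≈⟨ ⨾-cong ≈-refl clocked-≈ ⟩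
      reg v ⨾ Tr s ((reg state ⊗ id m) ⨾ Tr x ⌈ h ⌉)             ≈⟨ tighten ⟩
      Tr s ((id s ⊗ reg v) ⨾ (reg state ⊗ id m) ⨾ Tr x ⌈ h ⌉)    ≈⟨ Tr-cong ⨾-assoc ⟨
      Tr s (((id s ⊗ reg v) ⨾ (reg state ⊗ id m)) ⨾ Tr x ⌈ h ⌉)
        ≈⟨ Tr-cong (⨾-cong (≈-trans (reg-++ state v) (split₂ (reg state) (reg v))) ≈-refl) ⟨
      Tr s (reg (state ++ v) ⨾ Tr x ⌈ h ⌉)                       ∎

    if-step : Step IF (reg v ⨾ clocked) (Tr s (reg (state ++ v) ⨾ ⌈ k ⌉))
    if-step = modulo absorb (Tr-body (⨾-right (rule (if x h longest-d))))
      (Tr-cong (⨾-cong ≈-refl (⨾-cong ≈-refl (⊗-cong (≡⇒≈ (sym (⌈elims⌉ x))) ≈-refl))))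

    result : ∃[ f′ ] ∃[ w ] Productive f v f′ w
    result with values-⨾ k (state ++ v)
    ... | u , r with splitAt s u
    ... | state′ , w , refl with ⇝⇒Star (⇝-≈ʳ
          (⇝-map (Tr s) Tr-cong Tr-body (⇝-⨾ˡ {h = joins (s + n)} (⇝-⊗ r (done ≈-refl))))
          (≈-trans (Tr-cong (begin
            (values u ⊗ (⌈ k ⌉ ⨾ delays (s + n))) ⨾ joins (s + n)
                                                 ≈⟨ ⨾-reg ⌈ k ⌉ u ⟩
            ⌈ k ⌉ ⨾ reg u                        ≈⟨ ⨾-cong ≈-refl (reg-++ state′ w) ⟩
            ⌈ k ⌉ ⨾ (reg state′ ⊗ reg w)         ≈⟨ ⨾-cong ≈-refl (split₁ (reg state′) (reg w)) ⟩
            ⌈ k ⌉ ⨾ (reg state′ ⊗ id n) ⨾ (id s ⊗ reg w)    ≈⟨ ⨾-assoc ⟨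
            (⌈ k ⌉ ⨾ (reg state′ ⊗ id n)) ⨾ (id s ⊗ reg w)  ∎))
          (≈-sym tightenʳ)))
    -- The evaluated vector `u` holds the next state and the output: `reg state′` stays in the loop,
    -- `reg w` leaves it by tightening. The equation `q` is absorbed by the (Str) step.
    ... | c₃ , q , steps = _ , w , _ , _ , c₃ , mealy-step , if-step ,
      modulo ≈-refl (Tr-body (rule (str k (state ++ v)))) q , steps

  -- States

  -- The stream starts at tick `suc i`, because the delay contents after tick `i` already account
  -- for the input at tick `i`.
  after : ∀ {m} → ℕ → Stream m → Stream m
  after i σ k = σ (suc (k + i))

  splice : ∀ {m} → ℕ → Stream m → Stream m → Stream m
  splice i       σ τ zero    = σ 0
  splice zero    σ τ (suc s) = τ s
  splice (suc i) σ τ (suc s) = splice i (λ r → σ (suc r)) τ s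

  splice-≤ : ∀ {m} i (σ τ : Stream m) → splice i σ τ ≡⟨≤ i ⟩ σ
  splice-≤ i       σ τ {zero}  _         = refl
  splice-≤ (suc i) σ τ {suc s} (s≤s s≤i) = splice-≤ i (λ r → σ (suc r)) τ s≤i

  after-splice : ∀ {m} i (σ τ : Stream m) k → after i (splice i σ τ) k ≡ τ k
  after-splice zero    σ τ k = cong τ (ℕ.+-identityʳ k)
  after-splice (suc i) σ τ k = trans
    (cong (splice i (λ r → σ (suc r)) τ) (ℕ.+-suc k i))
    (after-splice i (λ r → σ (suc r)) τ k)

  ≤-or-after : ∀ i s → s ≤ i ⊎ ∃[ k ] s ≡ suc (k + i)
  ≤-or-after i s with ℕ.≤-<-connex s i
  ... | inj₁ s≤i = inj₁ s≤i
  ... | inj₂ i<s = inj₂ (s ∸ suc i , sym (trans (sym (ℕ.+-suc (s ∸ suc i) i)) (ℕ.m∸n+n≡m i<s)))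

  -- The contents of the delays of f after tick t.
  state : ∀ {m n} (f : SCirc m n) → Stream m → ℕ → Vec Value (#delays f)
  state (prim p)   σ t = []
  state fork       σ t = []
  state join       σ t = []
  state intro      σ t = []
  state elim       σ t = []
  state (id n)     σ t = []
  state (swap m n) σ t = []
  state (f ⨾ g)    σ t = state f σ t ++ state g (apply ⟦ f ⟧ˢ σ) t
  state (_⊗_ {m = m} f g) σ t = state f (takeˢ m σ) t ++ state g (dropˢ m σ) t
  state (val v _)  σ t = []
  state delay      σ t = σ t
  state (Tr x f)   σ t = state f (lfp (feedback x ⟦ f ⟧ˢ σ) ++ˢ σ) t

  -- The index `bound s` depends only on `x` and `s`, so both fixed points are read off at the same
  -- iterate and the iterates can be compared.
  lfp-causal : ∀ {x m n} (F : StreamFun (x + m) (x + n)) {σ τ} t → σ ≡⟨≤ t ⟩ τ →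
               lfp (feedback x F σ) ≡⟨≤ t ⟩ lfp (feedback x F τ)
  lfp-causal {x} F {σ} {τ} t σ≡τ {s} s≤t = iterates (LeastFixedPoint.bound (feedback x F σ) s) s≤t
    where
    open LeastFixedPoint using (iter)
    iterates : ∀ k → iter (feedback x F σ) k ≡⟨≤ t ⟩ iter (feedback x F τ) k
    iterates zero    _   = refl
    iterates (suc k) r≤t = cong (take x)
      (causal≤ F t (λ q≤t → cong₂ _++_ (iterates k q≤t) (σ≡τ q≤t)) r≤t)

  state-causal : ∀ {m n} (f : SCirc m n) {σ τ} t → σ ≡⟨≤ t ⟩ τ → state f σ t ≡ state f τ t
  state-causal (prim p)   t eq = refl
  state-causal fork       t eq = refl
  state-causal join       t eq = refl
  state-causal intro      t eq = refl
  state-causal elim       t eq = refl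
  state-causal (id n)     t eq = refl
  state-causal (swap m n) t eq = refl
  state-causal (f ⨾ g)    t eq =
    cong₂ _++_ (state-causal f t eq) (state-causal g t (causal≤ ⟦ f ⟧ˢ t eq))
  state-causal (_⊗_ {m = m} f g) t eq =
    cong₂ _++_ (state-causal f t (λ s≤t → cong (take m) (eq s≤t)))
               (state-causal g t (λ s≤t → cong (drop m) (eq s≤t)))
  state-causal (val v _)  t eq = refl
  state-causal delay      t eq = eq ℕ.≤-refl
  state-causal (Tr x f)   t eq =
    state-causal f t (λ s≤t → cong₂ _++_ (lfp-causal ⟦ f ⟧ˢ t eq s≤t) (eq s≤t))

  -- Two streams and two independent ticks are compared because cutting out inputs shifts the
  -- remaining stream in time.
  Resumable : ∀ {m n} → SCirc m n → Set
  Resumable f = ∀ {σ τ} i j → state f σ i ≡ state f τ j → (∀ k → after i σ k ≡ after j τ k) →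
                ∀ k → after i (apply ⟦ f ⟧ˢ σ) k ≡ after j (apply ⟦ f ⟧ˢ τ) k

  -- Replacing the least fixed point for σ after tick i by the one for τ after tick j
  -- yields another fixed point for σ.
  lfp-resume-⊑ : ∀ {x m n} (f : SCirc (x + m) (x + n)) → Resumable f → ∀ {σ τ} i j →
                 state (Tr x {m} {n} f) σ i ≡ state (Tr x {m} {n} f) τ j →
                 (∀ k → after i σ k ≡ after j τ k) →
                 ∀ k → after i (lfp (feedback x ⟦ f ⟧ˢ σ)) k ⊑ᵛ after j (lfp (feedback x ⟦ f ⟧ˢ τ)) k
  lfp-resume-⊑ {x} f resume {σ} {τ} i j state-eq in-eq k =
    subst (after i μ k ⊑ᵛ_) (after-splice i μ (after j ν) k)
      (lfp-induction (feedback x ⟦ f ⟧ˢ σ) (λ s → ⊑ᵛ-reflexive (fixed s)) (suc (k + i)))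
    where
    μ = lfp (feedback x ⟦ f ⟧ˢ σ)
    ν = lfp (feedback x ⟦ f ⟧ˢ τ)
    ρ : Stream x
    ρ = splice i μ (after j ν)
    ρ≡μ : ρ ++ˢ σ ≡⟨≤ i ⟩ μ ++ˢ σ
    ρ≡μ {s} s≤i = cong (_++ σ s) (splice-≤ i μ (after j ν) s≤i)
    fixed : ∀ s → take x (apply ⟦ f ⟧ˢ (ρ ++ˢ σ) s) ≡ ρ s
    fixed s with ≤-or-after i s
    ... | inj₁ s≤i = trans (cong (take x) (causal≤ ⟦ f ⟧ˢ i ρ≡μ s≤i))
      (trans (lfp-fixed (feedback x ⟦ f ⟧ˢ σ) s) (sym (splice-≤ i μ (after j ν) s≤i)))
    ... | inj₂ (l , refl) = trans
      (cong (take x) (resume {ρ ++ˢ σ} {ν ++ˢ τ} i j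
        (trans (state-causal f i ρ≡μ) state-eq)
        (λ q → cong₂ _++_ (after-splice i μ (after j ν) q) (in-eq q)) l))
      (trans (lfp-fixed (feedback x ⟦ f ⟧ˢ τ) (suc (l + j))) (sym (after-splice i μ (after j ν) l)))

  resumable : ∀ {m n} (f : SCirc m n) → Resumable f
  resumable (prim p)   i j _ in-eq k = cong ⟦ p ⟧ᵖ (in-eq k)
  resumable fork {σ} {τ} i j _ in-eq k = pointwise fork {σ} {τ} {suc (k + i)} {suc (k + j)} (in-eq k)
  resumable join {σ} {τ} i j _ in-eq k = pointwise join {σ} {τ} {suc (k + i)} {suc (k + j)} (in-eq k)
  resumable intro      i j _ in-eq k = refl
  resumable elim       i j _ in-eq k = refl
  resumable (id n)     i j _ in-eq k = in-eq k
  resumable (swap m n) i j _ in-eq k = cong (λ v → drop m v ++ take m v) (in-eq k)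
  resumable (f ⨾ g) {σ} {τ} i j state-eq in-eq =
    let eq₁ , eq₂ = ++-injective (state f σ i) (state f τ j) state-eq
    in resumable g i j eq₂ (resumable f i j eq₁ in-eq)
  resumable (_⊗_ {m = m} f g) {σ} {τ} i j state-eq in-eq k =
    let eq₁ , eq₂ = ++-injective (state f (takeˢ m σ) i) (state f (takeˢ m τ) j) state-eq
    in cong₂ _++_ (resumable f i j eq₁ (λ l → cong (take m) (in-eq l)) k)
                  (resumable g i j eq₂ (λ l → cong (drop m) (in-eq l)) k)
  -- Only ticks from 1 on are observed, and there a value emits ⊥.
  resumable (val v _)  i j _ _ k = refl
  resumable delay      i j state-eq in-eq zero    = state-eq
  resumable delay      i j state-eq in-eq (suc k) = in-eq k
  resumable (Tr x f) {σ} {τ} i j state-eq in-eq k =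
    -- The two feedback streams agree after their ticks because each bounds the other, by
    -- `lfp-resume-⊑` in both directions.
    cong (drop x) (resumable f i j state-eq (λ l → cong₂ _++_
      (⊑ᵛ-antisym (lfp-resume-⊑ f (resumable f) i j state-eq in-eq l)
                  (lfp-resume-⊑ f (resumable f) j i (sym state-eq) (λ q → sym (in-eq q)) l))
      (in-eq l)) k)

  -- Observational equivalence

  Productive-sound : ∀ {m n} {f f′ : SCirc m n} {v w} → Productive f v f′ w →
                     ∀ σ t → apply ⟦ f ⟧ˢ (v ∷ˢ σ) t ≡ (w ∷ˢ apply ⟦ f′ ⟧ˢ σ) t
  Productive-sound {f = f} {f′} {v} {w} (_ , _ , _ , mealy-step , if-step , str-step , value-steps) σ t =
    trans (apply-cong ⟦ f ⟧ˢ (λ s → sym (reg-at v σ s)) t)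
    (trans (≃⇒≗ reduction σ t) (reg-at w (apply ⟦ f′ ⟧ˢ σ) t))
    where
    reduction : reg v ⨾ f ≃ f′ ⨾ reg w
    reduction = Step-sound Mealy-sound mealy-step ⟨≃⟩ Step-sound IF-sound if-step ⟨≃⟩
      Step-sound Str-sound str-step ⟨≃⟩ Star-sound Value-sound value-steps

  -- A finite waveform is made total with ⊥; by causality the first `k` outputs depend on the
  -- waveform alone.
  toStream : ∀ {m k} → Vec (Vec Value m) k → Stream m
  toStream []       = ⊥ˢ
  toStream (v ∷ vs) = v ∷ˢ toStream vs

  toStream-injective : ∀ {m k} (us vs : Vec (Vec Value m) k) →
                       (∀ t → t < k → toStream us t ≡ toStream vs t) → us ≡ vs
  toStream-injective []       []       _  = refl
  toStream-injective (u ∷ us) (v ∷ vs) eq = cong₂ _∷_ (eq 0 (s≤s z≤n))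
    (toStream-injective us vs (λ t t<k → eq (suc t) (s≤s t<k)))

  prefix : ∀ {m} k → Stream m → Vec (Vec Value m) k
  prefix zero    σ = []
  prefix (suc k) σ = σ 0 ∷ prefix k (λ t → σ (suc t))

  toStream-prefix : ∀ {m} k (σ : Stream m) {t} → t < k → toStream (prefix k σ) t ≡ σ t
  toStream-prefix (suc k) σ {zero}  _         = refl
  toStream-prefix (suc k) σ {suc t} (s≤s t<k) = toStream-prefix k (λ s → σ (suc s)) t<k

  Produces-sound : ∀ {m n} {f : SCirc m n} {k} {vs : Vec (Vec Value m) k} {ws} → Produces f vs ws →
                   ∀ t → t < k → apply ⟦ f ⟧ˢ (toStream vs) t ≡ toStream ws t
  Produces-sound (p ∷ ps) zero    _         = Productive-sound p _ 0
  Produces-sound (p ∷ ps) (suc t) (s≤s t<k) = trans (Productive-sound p _ (suc t)) (Produces-sound ps t t<k)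

  produce : ∀ {m n} (f : SCirc m n) {k} (vs : Vec (Vec Value m) k) → ∃[ ws ] Produces f vs ws
  produce f []       = [] , []
  produce f (v ∷ vs) =
    let f′ , w , p  = productive f v
        ws   , ps = produce f′ vs
    in w ∷ ws , p ∷ ps

  ∼⇒agree : ∀ {m n} {f g : SCirc m n} c → f ∼[ c ] g →
            ∀ σ t → t ≤ ∣V∣ ^ c → apply ⟦ f ⟧ˢ σ t ≡ apply ⟦ g ⟧ˢ σ t
  ∼⇒agree {f = f} {g} c f∼g σ t t≤N with f∼g (prefix (∣V∣ ^ c + 1) σ)
  ... | ws , p , q = trans (sym (restrict f)) (trans (Produces-sound p t t<N+1)
      (trans (sym (Produces-sound q t t<N+1)) (restrict g)))
    where
    -- Ticks are numbered from 0, so this length reaches tick ∣V∣ ^ c.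
    t<N+1 : t < ∣V∣ ^ c + 1
    t<N+1 = subst (t <_) (ℕ.+-comm 1 (∣V∣ ^ c)) (s≤s t≤N)
    restrict : ∀ h → apply ⟦ h ⟧ˢ (toStream (prefix (∣V∣ ^ c + 1) σ)) t ≡ apply ⟦ h ⟧ˢ σ t
    restrict h = causal ⟦ h ⟧ˢ t (λ s≤t → toStream-prefix _ σ (ℕ.≤-<-trans s≤t t<N+1))

  ∣V∣>0 : 0 < ∣V∣
  ∣V∣>0 = ℕ.≤-<-trans z≤n (Fin.toℕ<n (Inverse.to finite •))

  -- A repeated pair of states allows the inputs between the two occurrences to be cut out.
  agree⇒≗ : ∀ {m n} (f g : SCirc m n) c → #delays f + #delays g ≤ c →
            (∀ σ t → t ≤ ∣V∣ ^ c → apply ⟦ f ⟧ˢ σ t ≡ apply ⟦ g ⟧ˢ σ t) → ⟦ f ⟧ˢ ≗ˢ ⟦ g ⟧ˢ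
  agree⇒≗ {m} {n} f g c bound agree σ t = <-rec (λ t → ∀ σ → apply ⟦ f ⟧ˢ σ t ≡ apply ⟦ g ⟧ˢ σ t) step t σ
    where
    d = #delays f + #delays g
    step : ∀ t → (∀ {s} → s < t → ∀ σ → apply ⟦ f ⟧ˢ σ s ≡ apply ⟦ g ⟧ˢ σ s) →
           ∀ σ → apply ⟦ f ⟧ˢ σ t ≡ apply ⟦ g ⟧ˢ σ t
    step t rec σ with ℕ.≤-<-connex t (∣V∣ ^ c)
    ... | inj₁ t≤N = agree σ t t≤N
    ... | inj₂ N<t
      -- Ticks 0 to ∣V∣ ^ d outnumber the ∣V∣ ^ d joint states, and both occurrences lie before `t`
      -- because ∣V∣ ^ d ≤ ∣V∣ ^ c < t.
      with a , b , i<j , eq ← Fin.pigeonhole (ℕ.n<1+n (∣V∣ ^ d))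
                                (λ i → encode (state f σ (toℕ i) ++ state g σ (toℕ i)))
      with ++-injective (state f σ (toℕ a)) (state f σ (toℕ b)) (encode-injective eq)
         | ≤-or-after (toℕ b) t
    ... | _ | inj₁ t≤j = contradiction (ℕ.≤-trans t≤j j≤N) (ℕ.<⇒≱ N<t)
      where
      j≤N : toℕ b ≤ ∣V∣ ^ c
      j≤N = ℕ.≤-trans (ℕ.≤-pred (Fin.toℕ<n b)) (ℕ.^-monoʳ-≤ ∣V∣ {{>-nonZero ∣V∣>0}} bound)
    ... | eq-f , eq-g | inj₂ (k , refl) =
      -- Tick `suc (k + j)` of `σ` becomes the earlier tick `suc (k + i)` of `σ′`, where the
      -- induction hypothesis applies; one cut serves both circuits because the joint state recurs.
      trans (shortcut f eq-f) (trans (rec (s≤s (ℕ.+-monoʳ-< k i<j)) σ′) (sym (shortcut g eq-g)))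
      where
      i = toℕ a
      j = toℕ b
      σ′ : Stream m
      σ′ = splice i σ (after j σ)
      shortcut : ∀ h → state h σ i ≡ state h σ j → after j (apply ⟦ h ⟧ˢ σ) k ≡ after i (apply ⟦ h ⟧ˢ σ′) k
      shortcut h h-eq = resumable h {σ} {σ′} j i
        (trans (sym h-eq) (sym (state-causal h i (splice-≤ i σ (after j σ)))))
        (λ l → sym (after-splice i σ (after j σ) l)) k

  -- `Produces` is only a relation. Soundness makes its outputs functional, so the waveforms found
  -- separately for `f` and `g` must coincide.
  ≗⇒∼ : ∀ {m n} (f g : SCirc m n) c → ⟦ f ⟧ˢ ≗ˢ ⟦ g ⟧ˢ → f ∼[ c ] g
  ≗⇒∼ f g c f≗g vs with produce f vs | produce g vs
  ... | ws , p | ws′ , q = ws , p , subst (Produces g vs) ws′≡ws q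
    where
    ws′≡ws : ws′ ≡ ws
    ws′≡ws = toStream-injective ws′ ws λ t t<k →
      trans (sym (Produces-sound q t t<k)) (trans (sym (f≗g _ t)) (Produces-sound p t t<k))

theorem5p39 : (S : Signature) (I : Interpretation S) →
  let open Circuits S
      open Semantics S I
  in ∀ {m n} (f g : SCirc m n) (c : ℕ) →
     #delays f + #delays g ≤ c →
     f ∼[ c ] g ⇔ ⟦ f ⟧ˢ ≗ˢ ⟦ g ⟧ˢ
theorem5p39 S I f g c bound = mk⇔
  (λ f∼g → agree⇒≗ f g c bound (∼⇒agree c f∼g))
  (≗⇒∼ f g c)
  where open Adequacy S I
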